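{- A hereditary family of graphs has the Erdős–Hajnal property if and only if it has the polynomial close Rödl property.
   Context: A family of finite graphs is hereditary if closed under induced subgraphs. $\hom(G)$ is the size of a largest clique or independent set in $G$. $\mathcal{F}$ has the Erdős–Hajnal property if there is $c>0$ such that every $G\in\mathcal{F}$ on $n$ vertices has $\hom(G)\ge n^c$. A vertex set $S$ is $\varepsilon$-homogeneous if the edge density of $G[S]$ is at most $\varepsilon$ or at least $1-\varepsilon$. A graph $G$ on $n$ vertices is $\alpha$-close to $\mathcal{F}$ if one can add or delete at most $\alpha n^2/2$ edges of $G$ to obtain a graph in $\mathcal{F}$. $\mathcal{F}$ has the polynomial close Rödl property if there are $C,d>0$ such that for every $0<\varepsilon<1/2$, every graph on $n$ vertices that is $\varepsilon^{d}$-close to $\mathcal{F}$ contains an $\varepsilon$-homogeneous set of size at least $\varepsilon^{C}n$. -}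

module Defs where

open import Data.Nat using (ℕ; zero; suc; _+_; _*_; _∸_; _^_; _≤_; _<ᵇ_)
open import Data.Bool using (Bool; true; false; _∧_; _xor_; if_then_else_; not)
open import Data.Fin using (Fin; toℕ)
open import Data.Product using (Σ; _×_)
open import Data.Sum using (_⊎_)
open import Relation.Binary.PropositionalEquality using (_≡_; _≢_)
open import Function.Definitions using (Injective)
open import Function.Bundles using (_⇔_)

record Graph (n : ℕ) : Set where
  field
    adj    : Fin n → Fin n → Bool
    sym    : ∀ i j → adj i j ≡ adj j i
    irrefl : ∀ i → adj i i ≡ false
open Graph public

induce : ∀ {m n} → Graph n → (Fin m → Fin n) → Graph m
induce G f = record
  { adj = λ i j → adj G (f i) (f j)
  ; sym = λ i j → sym G (f i) (f j)
  ; irrefl = λ i → irrefl G (f i) }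

Family : Set₁
Family = ∀ {n} → Graph n → Set

-- Hereditary: closed under induced subgraphs (including isomorphic copies).
Hereditary : Family → Set
Hereditary F = ∀ {m n} (G : Graph n) (f : Fin m → Fin n) →
  Injective _≡_ _≡_ f → F G → F (induce G f)

sumFin : ∀ n → (Fin n → ℕ) → ℕ
sumFin zero    f = 0
sumFin (suc n) f = f Fin.zero + sumFin n (λ i → f (Fin.suc i))
  where import Data.Fin as Fin

pairCount : ∀ {n} → (Fin n → Fin n → Bool) → ℕ
pairCount {n} R = sumFin n (λ i → sumFin n (λ j →
  if (toℕ i <ᵇ toℕ j) ∧ R i j then 1 else 0))

Subset : ℕ → Set
Subset n = Fin n → Bool

size : ∀ {n} → Subset n → ℕ
size {n} S = sumFin n (λ i → if S i then 1 else 0)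

edgesIn : ∀ {n} → Graph n → Subset n → ℕ
edgesIn G S = pairCount (λ i j → S i ∧ S j ∧ adj G i j)

dist : ∀ {n} → Graph n → Graph n → ℕ
dist G H = pairCount (λ i j → adj G i j xor adj H i j)

IsClique : ∀ {n} → Graph n → Subset n → Set
IsClique G S = ∀ i j → S i ≡ true → S j ≡ true → i ≢ j → adj G i j ≡ true

IsIndependent : ∀ {n} → Graph n → Subset n → Set
IsIndependent G S = ∀ i j → S i ≡ true → S j ≡ true → i ≢ j → adj G i j ≡ false

-- Erdős–Hajnal property with exponent c = p / q > 0:
-- every G ∈ F on n vertices has a clique or independent set S with |S| ≥ n^(p/q),
-- i.e. n^p ≤ |S|^q  (this is hom(G) ≥ n^c).
ErdosHajnal : Family → Set
ErdosHajnal F = Σ ℕ λ p → Σ ℕ λ q → (1 ≤ p) × (1 ≤ q) ×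
  (∀ {n} (G : Graph n) → F G →
     Σ (Subset n) λ S → (IsClique G S ⊎ IsIndependent G S) × (n ^ p ≤ size S ^ q))

-- ε = a / b.  S is ε-homogeneous: with s = |S| and e = e(G[S]),
-- e ≤ ε·s(s-1)/2  or  e ≥ (1-ε)·s(s-1)/2.
EpsHomogeneous : ∀ {n} → ℕ → ℕ → Graph n → Subset n → Set
EpsHomogeneous a b G S =
  (2 * b * edgesIn G S ≤ a * (size S * (size S ∸ 1))) ⊎
  ((b ∸ a) * (size S * (size S ∸ 1)) ≤ 2 * b * edgesIn G S)

-- G (on n vertices) is (a/b)^(d₁/d₂)-close to F: some H ∈ F on the same vertex set
-- with dist(G,H) ≤ (a/b)^(d₁/d₂) · n²/2, i.e. (2·dist)^d₂ · b^d₁ ≤ a^d₁ · n^(2·d₂).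
CloseTo : Family → ℕ → ℕ → ℕ → ℕ → ∀ {n} → Graph n → Set
CloseTo F a b d₁ d₂ {n} G = Σ (Graph n) λ H → F H ×
  ((2 * dist G H) ^ d₂ * b ^ d₁ ≤ a ^ d₁ * n ^ (2 * d₂))

-- Polynomial close Rödl property with C = C₁/C₂ > 0, d = d₁/d₂ > 0:
-- for every ε = a/b ∈ (0,1/2), every G that is ε^d-close to F has an ε-homogeneous
-- set S with |S| ≥ ε^C n, i.e. a^C₁ · n^C₂ ≤ b^C₁ · |S|^C₂.
PolyCloseRodl : Family → Set
PolyCloseRodl F = Σ ℕ λ C₁ → Σ ℕ λ C₂ → Σ ℕ λ d₁ → Σ ℕ λ d₂ →
  (1 ≤ C₁) × (1 ≤ C₂) × (1 ≤ d₁) × (1 ≤ d₂) ×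
  (∀ (a b : ℕ) → 1 ≤ a → 2 * a + 1 ≤ b →
     ∀ {n} (G : Graph n) → CloseTo F a b d₁ d₂ G →
     Σ (Subset n) λ S → EpsHomogeneous a b G S × (a ^ C₁ * n ^ C₂ ≤ b ^ C₁ * size S ^ C₂))

{-# OPTIONS --safe #-}
module Submission where

-- Erdős–Hajnal ⇒ Rödl.  Let H ∈ F and let t ≈ 4/ε be a power of two.  If neither H nor its complement
-- has a large subset all of whose degrees exceed the fraction 1 − 1/t, then the Kleitman–Winston
-- argument shows that H has few homogeneous k-sets.  Deleting one vertex at a time, each chosen by
-- averaging, leaves m = poly(t) vertices spanning no homogeneous k-set, which contradicts
-- hom ≥ m^c ≥ k on the induced subgraph.  So H has a very sparse or very dense set of size at least
-- ε^C n, and it remains ε-homogeneous in any G that is ε^d-close to H, once d is large.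
--
-- Rödl ⇒ Erdős–Hajnal.  A member of F is at distance 0 from F.  Taking ε = 1/r² for r a small power
-- of n gives an ε-homogeneous set of size at least r, and thinning it by the same averaging to r
-- vertices leaves less than one edge (or non-edge).

open import Defs
open import Function.Bundles using (_⇔_; mk⇔)
open import Function.Definitions using (Injective)
open import Data.Nat hiding (_≟_)
open import Data.Nat.Properties hiding (_≟_)
open import Data.Nat.DivMod using (m≡m%n+[m/n]*n; m%n<n; m/n*n≤m; m≥n⇒m/n>0)
open import Data.Nat.Tactic.RingSolver using (solve-∀)
open import Data.Bool using (Bool; true; false; _∧_; _xor_; if_then_else_; not)
open import Data.Fin as Fin using (Fin; toℕ)
open import Data.Fin.Properties using (_≟_)
import Data.Fin.Properties as Finₚ
open import Data.Product using (Σ; _×_; _,_; proj₁; proj₂; ∃)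
open import Data.Sum using (_⊎_; inj₁; inj₂)
open import Data.Empty using (⊥; ⊥-elim)
open import Relation.Nullary using (¬_; Dec; yes; no; ⌊_⌋)
open import Relation.Unary using (Decidable)
open import Relation.Binary.PropositionalEquality as ≡
  using (_≡_; _≢_; refl; cong; cong₂; subst; subst₂; trans)

-- Erdős-Hajnal by itself gives a homogeneous set of size n^c only, while the goal is a set of size
-- linear in n that also survives the change of ε^d n²/2 pairs. So the hypothesis is spent on
-- samples of bounded size m, and the large set comes from the contrapositive. The balance behind
-- the polynomial bound: with D ≈ n/m³, Kleitman-Winston leaves at most D^k (1 + M)^J ordered
-- k-cliques, where M is polynomial in m. Passing to m vertices scales this by (m/n)^k, leaving
-- about (1 + M)^J m^(-2k), so k only has to exceed a constant multiple of J. Since J is of order t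
-- log m while k = m^(1/q) is a power of m, a fixed power of t suffices for m. Averages stand in for
-- random choices, and inequalities are kept in ℕ by clearing denominators and moving subtracted
-- terms to the other side.

private
  variable
    n : ℕ

-- Finite sums

sum-cong : ∀ {n} {f g : Fin n → ℕ} → (∀ i → f i ≡ g i) → sumFin n f ≡ sumFin n g
sum-cong {zero}  h = refl
sum-cong {suc n} h = cong₂ _+_ (h Fin.zero) (sum-cong (λ i → h (Fin.suc i)))

sum-mono : ∀ {n} {f g : Fin n → ℕ} → (∀ i → f i ≤ g i) → sumFin n f ≤ sumFin n g
sum-mono {zero}  h = z≤n
sum-mono {suc n} h = +-mono-≤ (h Fin.zero) (sum-mono (λ i → h (Fin.suc i)))

sum-+ : ∀ {n} (f g : Fin n → ℕ) → sumFin n (λ i → f i + g i) ≡ sumFin n f + sumFin n g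
sum-+ {zero}  f g = refl
sum-+ {suc n} f g
  rewrite sum-+ (λ i → f (Fin.suc i)) (λ i → g (Fin.suc i)) =
  interchange (f Fin.zero) (g Fin.zero) _ _
  where
  interchange : ∀ a b c d → a + b + (c + d) ≡ a + c + (b + d)
  interchange = solve-∀

sum-* : ∀ {n} c (f : Fin n → ℕ) → sumFin n (λ i → c * f i) ≡ c * sumFin n f
sum-* {zero}  c f = ≡.sym (*-zeroʳ c)
sum-* {suc n} c f rewrite sum-* c (λ i → f (Fin.suc i)) =
  ≡.sym (*-distribˡ-+ c (f Fin.zero) _)

sum-zero : ∀ n → sumFin n (λ _ → 0) ≡ 0
sum-zero zero    = refl
sum-zero (suc n) = sum-zero n

sum-swap : ∀ {m n} (f : Fin m → Fin n → ℕ) →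
  sumFin m (λ i → sumFin n (f i)) ≡ sumFin n (λ j → sumFin m (λ i → f i j))
sum-swap {zero}  {n} f = ≡.sym (sum-zero n)
sum-swap {suc m} {n} f rewrite sum-swap (λ i → f (Fin.suc i)) =
  ≡.sym (sum-+ (f Fin.zero) _)

term≤sum : ∀ {n} (f : Fin n → ℕ) i → f i ≤ sumFin n f
term≤sum f Fin.zero    = m≤m+n _ _
term≤sum f (Fin.suc i) = ≤-trans (term≤sum (λ j → f (Fin.suc j)) i) (m≤n+m _ _)

sum-remove : ∀ {n} (g : Fin n → ℕ) v →
  g v + sumFin n (λ u → if ⌊ u ≟ v ⌋ then 0 else g u) ≡ sumFin n g
sum-remove g Fin.zero = refl
sum-remove {suc n} g (Fin.suc v) = begin
  g (Fin.suc v) + (g Fin.zero + _)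
    ≡⟨ solve-rotate (g (Fin.suc v)) (g Fin.zero) _ ⟩
  g Fin.zero + (g (Fin.suc v) + _)
    ≡⟨ cong (λ x → g Fin.zero + (g (Fin.suc v) + x)) (sum-cong pointwise) ⟩
  g Fin.zero + (g (Fin.suc v) + _)
    ≡⟨ cong (g Fin.zero +_) (sum-remove (λ u → g (Fin.suc u)) v) ⟩
  g Fin.zero + sumFin n (λ u → g (Fin.suc u)) ∎
  where
  open ≡.≡-Reasoning
  solve-rotate : ∀ a b c → a + (b + c) ≡ b + (a + c)
  solve-rotate = solve-∀
  pointwise : ∀ u → (if ⌊ Fin.suc u ≟ Fin.suc v ⌋ then 0 else g (Fin.suc u))
                  ≡ (if ⌊ u ≟ v ⌋ then 0 else g (Fin.suc u))
  pointwise u with u ≟ v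
  ... | yes _ = refl
  ... | no  _ = refl

-- By injectivity, zeroing `g` at the first value of `f` changes none of the other summands, so
-- `sum-remove` pays for that value and the induction goes on.
sum-injection : ∀ {m n} (f : Fin m → Fin n) → Injective _≡_ _≡_ f → (g : Fin n → ℕ) →
  sumFin m (λ i → g (f i)) ≤ sumFin n g
sum-injection {zero}      f inj g = z≤n
sum-injection {suc m} {n} f inj g = begin
  g v + sumFin m (λ i → g (f (Fin.suc i)))  ≤⟨ +-monoʳ-≤ (g v) (sum-mono pointwise) ⟩
  g v + sumFin m (λ i → g′ (f (Fin.suc i)))
    ≤⟨ +-monoʳ-≤ (g v) (sum-injection (λ i → f (Fin.suc i)) (λ e → Finₚ.suc-injective (inj e)) g′) ⟩
  g v + sumFin n g′                         ≡⟨ sum-remove g v ⟩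
  sumFin n g                                ∎
  where
  open ≤-Reasoning
  v = f Fin.zero
  g′ : Fin n → ℕ
  g′ u = if ⌊ u ≟ v ⌋ then 0 else g u
  pointwise : ∀ i → g (f (Fin.suc i)) ≤ g′ (f (Fin.suc i))
  pointwise i with f (Fin.suc i) ≟ v
  ... | no  _ = ≤-refl
  ... | yes e with () ← inj e

-- Vertex sets

infix 4 _∈_ _⊆_
_∈_ : Fin n → Subset n → Set
v ∈ S = S v ≡ true

_⊆_ : Subset n → Subset n → Set
S ⊆ S′ = ∀ v → v ∈ S → v ∈ S′

infixl 6 _∖_
_∖_ : Subset n → Fin n → Subset n
(S ∖ v) u = S u ∧ not ⌊ u ≟ v ⌋

full : ∀ {n} → Subset n
full _ = true

nbrs : Graph n → Subset n → Fin n → Subset n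
nbrs G S v u = S u ∧ adj G v u

sumOn : ∀ {n} → Subset n → (Fin n → ℕ) → ℕ
sumOn {n} S f = sumFin n (λ v → if S v then f v else 0)

∧-true : ∀ {x y} → x ∧ y ≡ true → x ≡ true × y ≡ true
∧-true {true} {true} _ = refl , refl

∧-intro : ∀ {x y} → x ≡ true → y ≡ true → x ∧ y ≡ true
∧-intro refl refl = refl

∖-intro : ∀ {S : Subset n} {u v} → u ∈ S → u ≢ v → u ∈ S ∖ v
∖-intro {u = u} {v} u∈S u≢v with u ≟ v
... | yes e = ⊥-elim (u≢v e)
... | no  _ = ∧-intro u∈S refl

∖⊆ : ∀ (S : Subset n) v → S ∖ v ⊆ S
∖⊆ S v u u∈ = proj₁ (∧-true u∈)

∖-≢ : ∀ (S : Subset n) {v u} → u ∈ S ∖ v → u ≢ v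
∖-≢ S {v} {u} u∈ with u ≟ v
... | no  u≢v = u≢v
... | yes _ with () ← proj₂ (∧-true {S u} u∈)

sumOn-mono-⊆ : ∀ {S S′ : Subset n} {f g} → S ⊆ S′ →
  (∀ v → v ∈ S → f v ≤ g v) → sumOn S f ≤ sumOn S′ g
sumOn-mono-⊆ {S = S} {S′} {f} {g} S⊆S′ f≤g = sum-mono pointwise
  where
  pointwise : ∀ v → (if S v then f v else 0) ≤ (if S′ v then g v else 0)
  pointwise v with S v in e
  ... | false = z≤n
  ... | true rewrite S⊆S′ v e = f≤g v e

sumOn-mono : ∀ {S : Subset n} {f g} → (∀ v → v ∈ S → f v ≤ g v) → sumOn S f ≤ sumOn S g
sumOn-mono {S = S} = sumOn-mono-⊆ {S = S} {S} (λ _ v∈S → v∈S)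

sumOn-+ : ∀ (S : Subset n) f g → sumOn S (λ v → f v + g v) ≡ sumOn S f + sumOn S g
sumOn-+ {n} S f g = trans (sum-cong pointwise)
  (sum-+ {n} (λ v → if S v then f v else 0) (λ v → if S v then g v else 0))
  where
  pointwise : ∀ v → (if S v then f v + g v else 0) ≡
                    (if S v then f v else 0) + (if S v then g v else 0)
  pointwise v with S v
  ... | true  = refl
  ... | false = refl

sumOn-* : ∀ (S : Subset n) c f → sumOn S (λ v → c * f v) ≡ c * sumOn S f
sumOn-* {n} S c f = trans (sum-cong pointwise) (sum-* {n} c (λ v → if S v then f v else 0))
  where
  pointwise : ∀ v → (if S v then c * f v else 0) ≡ c * (if S v then f v else 0)
  pointwise v with S v
  ... | true  = refl
  ... | false = ≡.sym (*-zeroʳ c)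

sumOn-const : ∀ (S : Subset n) c → sumOn S (λ _ → c) ≡ c * size S
sumOn-const S c = trans (sum-cong (λ v → cong (λ x → if S v then x else 0) (≡.sym (*-identityʳ c))))
                        (sumOn-* S c (λ _ → 1))

term≤sumOn : ∀ (S : Subset n) f {v} → v ∈ S → f v ≤ sumOn S f
term≤sumOn S f {v} v∈S = subst (λ s → (if s then f v else 0) ≤ sumOn S f) v∈S
  (term≤sum (λ u → if S u then f u else 0) v)

sum-point : ∀ (v : Fin n) c → sumFin n (λ u → if ⌊ u ≟ v ⌋ then c else 0) ≡ c
sum-point {n} v c = begin
  sumFin n g  ≡⟨ ≡.sym (sum-remove g v) ⟩
  g v + sumFin n (λ u → if ⌊ u ≟ v ⌋ then 0 else g u)
    ≡⟨ cong₂ _+_ at-v (trans (sum-cong off-v) (sum-zero n)) ⟩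
  c + 0       ≡⟨ +-identityʳ c ⟩
  c           ∎
  where
  open ≡.≡-Reasoning
  g : Fin n → ℕ
  g u = if ⌊ u ≟ v ⌋ then c else 0
  at-v : g v ≡ c
  at-v with v ≟ v
  ... | yes _ = refl
  ... | no ¬p = ⊥-elim (¬p refl)
  off-v : ∀ u → (if ⌊ u ≟ v ⌋ then 0 else g u) ≡ 0
  off-v u with u ≟ v
  ... | yes _ = refl
  ... | no  _ = refl

size-mono : ∀ {S S′ : Subset n} → S ⊆ S′ → size S ≤ size S′
size-mono S⊆S′ = sumOn-mono-⊆ S⊆S′ (λ _ _ → ≤-refl)

size-full : ∀ n → size (full {n}) ≡ n
size-full zero    = refl
size-full (suc n) = cong suc (size-full n)

size≤n : ∀ (S : Subset n) → size S ≤ n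
size≤n {n} S = ≤-trans (size-mono {S = S} {full} (λ _ _ → refl)) (≤-reflexive (size-full n))

size-∖ : ∀ (S : Subset n) {v} → v ∈ S → suc (size (S ∖ v)) ≡ size S
size-∖ S {v} v∈S = begin
  1 + size (S ∖ v)  ≡⟨ cong₂ _+_ (cong (λ s → if s then 1 else 0) (≡.sym v∈S)) (sum-cong pointwise) ⟩
  g v + sumFin _ (λ u → if ⌊ u ≟ v ⌋ then 0 else g u) ≡⟨ sum-remove g v ⟩
  size S ∎
  where
  open ≡.≡-Reasoning
  g : Fin _ → ℕ
  g u = if S u then 1 else 0
  pointwise : ∀ u → (if (S ∖ v) u then 1 else 0) ≡ (if ⌊ u ≟ v ⌋ then 0 else g u)
  pointwise u with u ≟ v | S u
  ... | yes _ | true  = refl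
  ... | yes _ | false = refl
  ... | no  _ | true  = refl
  ... | no  _ | false = refl

search : ∀ {n} (S : Subset n) {P : Fin n → Set} → Decidable P →
  (∃ λ v → v ∈ S × P v) ⊎ (∀ v → v ∈ S → ¬ P v)
search {zero} S P? = inj₂ (λ ())
search {suc n} S P? with S Fin.zero in e | P? Fin.zero | search (λ v → S (Fin.suc v)) (λ v → P? (Fin.suc v))
... | _     | _     | inj₁ (v , v∈S , pv) = inj₁ (Fin.suc v , v∈S , pv)
... | true  | yes p | inj₂ _ = inj₁ (Fin.zero , e , p)
... | false | _     | inj₂ h = inj₂ λ { Fin.zero e′ _ → case-⊥ e e′ ; (Fin.suc v) → h v }
  where
  case-⊥ : ∀ {x} → x ≡ false → x ≡ true → ⊥
  case-⊥ refl ()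
... | true  | no ¬p | inj₂ h = inj₂ λ { Fin.zero _ → ¬p ; (Fin.suc v) → h v }

nonempty : ∀ (S : Subset n) → 1 ≤ size S → ∃ (_∈ S)
nonempty {suc n} S 1≤s with S Fin.zero in e
... | true  = Fin.zero , e
... | false with v , v∈S ← nonempty (λ u → S (Fin.suc u)) 1≤s = Fin.suc v , v∈S

enumerate : ∀ {n} (S : Subset n) →
  Σ (Fin (size S) → Fin n) λ f → Injective _≡_ _≡_ f × (∀ i → f i ∈ S)
enumerate {zero} S = (λ ()) , (λ { {()} }) , λ ()
enumerate {suc n} S with S Fin.zero in e | enumerate (λ v → S (Fin.suc v))
... | false | f , inj , f∈ =
  (λ i → Fin.suc (f i)) , (λ eq → inj (Finₚ.suc-injective eq)) , f∈
... | true  | f , inj , f∈ = f′ , inj′ , f′∈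
  where
  f′ : Fin (suc (size (λ v → S (Fin.suc v)))) → Fin (suc n)
  f′ Fin.zero    = Fin.zero
  f′ (Fin.suc i) = Fin.suc (f i)
  inj′ : Injective _≡_ _≡_ f′
  inj′ {Fin.zero}  {Fin.zero}  _  = refl
  inj′ {Fin.suc i} {Fin.suc j} eq = cong Fin.suc (inj (Finₚ.suc-injective eq))
  f′∈ : ∀ i → f′ i ∈ S
  f′∈ Fin.zero    = e
  f′∈ (Fin.suc i) = f∈ i

below-average : ∀ (S : Subset n) (f : Fin n → ℕ) {X} → 1 ≤ size S → sumOn S f ≤ X →
  ∃ λ v → v ∈ S × size S * f v ≤ X
below-average S f {X} 1≤s sum≤X with search S (λ v → size S * f v ≤? X)
... | inj₁ found = found
... | inj₂ none  = ⊥-elim (<-irrefl refl (begin-strict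
  X * size S                       <⟨ +-monoˡ-≤ (X * size S) 1≤s ⟩
  suc X * size S                   ≡⟨ ≡.sym (sumOn-const S (suc X)) ⟩
  sumOn S (λ _ → suc X)            ≤⟨ sumOn-mono {S = S} (λ v v∈S → ≰⇒> (none v v∈S)) ⟩
  sumOn S (λ v → size S * f v)     ≡⟨ sumOn-* S (size S) f ⟩
  size S * sumOn S f               ≤⟨ *-monoʳ-≤ (size S) sum≤X ⟩
  size S * X                       ≡⟨ *-comm (size S) X ⟩
  X * size S                       ∎))
  where open ≤-Reasoning

-- Counting ordered cliques

-- Irreflexivity keeps a chosen vertex out of its own neighbourhood, so no vertex repeats and each
-- k-clique is counted k! times. In particular `cliques G 1 S` unfolds to `size S`, and
-- `cliques G 2 S` is a sum of degrees.
cliques : Graph n → ℕ → Subset n → ℕ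
cliques G zero    S = 1
cliques G (suc k) S = sumOn S (λ v → cliques G k (nbrs G S v))

nbrs-mono : ∀ (G : Graph n) {S S′} v → S ⊆ S′ → nbrs G S v ⊆ nbrs G S′ v
nbrs-mono G v S⊆S′ u u∈ with u∈S , vu ← ∧-true u∈ = ∧-intro (S⊆S′ u u∈S) vu

cliques-mono : ∀ (G : Graph n) k {S S′} → S ⊆ S′ → cliques G k S ≤ cliques G k S′
cliques-mono G zero    S⊆S′ = ≤-refl
cliques-mono G (suc k) {S} {S′} S⊆S′ =
  sumOn-mono-⊆ {S = S} {S′} S⊆S′ (λ v _ → cliques-mono G k (nbrs-mono G v S⊆S′))

cliques≤size^ : ∀ (G : Graph n) k S → cliques G k S ≤ size S ^ k
cliques≤size^ G zero    S = ≤-refl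
cliques≤size^ G (suc k) S = begin
  sumOn S (λ v → cliques G k (nbrs G S v))
    ≤⟨ sumOn-mono {S = S} (λ v _ → ≤-trans (cliques-mono G k (λ u u∈ → proj₁ (∧-true u∈))) (cliques≤size^ G k S)) ⟩
  sumOn S (λ _ → size S ^ k)  ≡⟨ sumOn-const S (size S ^ k) ⟩
  size S ^ k * size S         ≡⟨ *-comm (size S ^ k) (size S) ⟩
  size S * size S ^ k         ∎
  where open ≤-Reasoning

-- A clique through `v` has `v` in one of its k + 1 places, and its other k vertices form a clique
-- of neighbours of `v`.
cliques-delete : ∀ (G : Graph n) k S v →
  cliques G (suc k) S ≤ cliques G (suc k) (S ∖ v) + suc k * cliques G k (nbrs G S v)
cliques-delete {n} G k S v = begin
  cliques G (suc k) S  ≤⟨ sum-mono (pointwise k) ⟩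
  sumFin n (λ u → at u + (rest u + k * both k u))
    ≡⟨ trans (sum-+ at (λ u → rest u + k * both k u)) (cong₂ _+_ (sum-point v K) (sum-+ rest (λ u → k * both k u))) ⟩
  K + (sumFin n rest + sumFin n (λ u → k * both k u))
    ≤⟨ +-monoʳ-≤ K (+-monoʳ-≤ (sumFin n rest) (sum-both k)) ⟩
  K + (cliques G (suc k) (S ∖ v) + k * K)  ≡⟨ rotate K (cliques G (suc k) (S ∖ v)) (k * K) ⟩
  cliques G (suc k) (S ∖ v) + suc k * K    ∎
  where
  open ≤-Reasoning
  K = cliques G k (nbrs G S v)
  -- Three cases for a clique with first vertex u: u is `v`, `v` is avoided, or `v` fills one of the
  -- k later places. The factor k makes the value of `pred k` at zero harmless.
  at rest : Fin n → ℕ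
  at u = if ⌊ u ≟ v ⌋ then K else 0
  rest u = if (S ∖ v) u then cliques G k (nbrs G (S ∖ v) u) else 0
  both : ℕ → Fin n → ℕ
  both k u = if nbrs G S v u then cliques G (pred k) (nbrs G (nbrs G S v) u) else 0
  rotate : ∀ a b c → a + (b + c) ≡ b + (a + c)
  rotate = solve-∀

  sum-both : ∀ k → sumFin n (λ u → k * both k u) ≤ k * cliques G k (nbrs G S v)
  sum-both zero    = ≤-reflexive (sum-zero n)
  sum-both (suc k) = ≤-reflexive (sum-* (suc k) (both (suc k)))

  swap-⊆ : ∀ u → nbrs G (nbrs G S u) v ⊆ nbrs G (nbrs G S v) u
  swap-⊆ u w w∈ with w∈′ , vw ← ∧-true w∈ with w∈S , uw ← ∧-true {S w} w∈′ =
    ∧-intro (∧-intro w∈S vw) uw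

  delete-⊆ : ∀ u → nbrs G S u ∖ v ⊆ nbrs G (S ∖ v) u
  delete-⊆ u w w∈ with w∈′ , w≢v ← ∧-true w∈ with w∈S , uw ← ∧-true {S w} w∈′ =
    ∧-intro (∧-intro w∈S w≢v) uw

  nonadjacent-⊆ : ∀ u → adj G v u ≡ false → nbrs G S u ⊆ nbrs G (S ∖ v) u
  nonadjacent-⊆ u vu w w∈ with w∈S , uw ← ∧-true {S w} w∈ =
    ∧-intro (∖-intro {S = S} w∈S λ { refl → absurd (trans (≡.sym uw) (trans (sym G u w) vu)) }) uw
    where
    absurd : true ≢ false
    absurd ()

  adjacent : ∀ k u → cliques G k (nbrs G S u) ≤
    cliques G k (nbrs G (S ∖ v) u) + k * cliques G (pred k) (nbrs G (nbrs G S v) u)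
  adjacent zero    u = m≤m+n 1 _
  adjacent (suc k) u = ≤-trans (cliques-delete G k (nbrs G S u) v)
    (+-mono-≤ (cliques-mono G (suc k) (delete-⊆ u))
              (*-monoʳ-≤ (suc k) (cliques-mono G k (swap-⊆ u))))

  pointwise : ∀ k u → (if S u then cliques G k (nbrs G S u) else 0) ≤
    (if ⌊ u ≟ v ⌋ then cliques G k (nbrs G S v) else 0) +
    ((if (S ∖ v) u then cliques G k (nbrs G (S ∖ v) u) else 0) + k * both k u)
  pointwise k u with S u in eS | u ≟ v | adj G v u in ea
  ... | false | _        | _     = z≤n
  ... | true  | yes refl | _     = m≤m+n _ _
  ... | true  | no _     | true  = adjacent k u
  ... | true  | no _     | false = ≤-trans (cliques-mono G k (nonadjacent-⊆ u ea)) (m≤m+n _ _)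

sumOn-swap : ∀ {n} (S : Subset n) (h : Fin n → Fin n → ℕ) →
  sumOn S (λ v → sumOn S (h v)) ≡ sumOn S (λ u → sumOn S (λ v → h v u))
sumOn-swap {n} S h = trans (sum-cong push) (trans (sum-swap both) (sum-cong pull))
  where
  both : Fin n → Fin n → ℕ
  both v u = if S v then (if S u then h v u else 0) else 0
  push : ∀ v → (if S v then sumOn S (h v) else 0) ≡ sumFin n (both v)
  push v with S v
  ... | true  = refl
  ... | false = ≡.sym (sum-zero n)
  pull : ∀ u → sumFin n (λ v → both v u) ≡ (if S u then sumOn S (λ v → h v u) else 0)
  pull u with S u
  ... | true  = refl
  ... | false = trans (sum-cong none) (sum-zero n)
    where
    none : ∀ v → (if S v then 0 else 0) ≡ 0
    none v with S v
    ... | true  = refl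
    ... | false = refl

sumOn-∖ : ∀ (S : Subset n) v f →
  sumOn (S ∖ v) f ≡ sumOn S (λ u → if ⌊ u ≟ v ⌋ then 0 else f u)
sumOn-∖ S v f = sum-cong pointwise
  where
  pointwise : ∀ u → (if (S ∖ v) u then f u else 0) ≡
                    (if S u then (if ⌊ u ≟ v ⌋ then 0 else f u) else 0)
  pointwise u with S u | u ≟ v
  ... | true  | yes _ = refl
  ... | true  | no  _ = refl
  ... | false | _     = refl

-- Double counting: a k-clique is destroyed by deleting one of its k vertices and survives the other
-- |S| - k deletions. Only the upper bound is wanted for averaging.
cliques-average : ∀ (G : Graph n) k S →
  sumOn S (λ v → cliques G k (S ∖ v)) + k * cliques G k S ≤ size S * cliques G k S
cliques-average G zero S = ≤-reflexive (trans (+-identityʳ _) (≡.sym (*-identityʳ _)))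
cliques-average {n} G (suc k) S = begin
  sumOn S (λ v → cliques G (suc k) (S ∖ v)) + suc k * cliques G (suc k) S
    ≡⟨ cong₂ _+_ exchange (≡.sym (sumOn-* S (suc k) T)) ⟩
  sumOn S X + sumOn S (λ u → suc k * T u)
    ≡⟨ ≡.sym (sumOn-+ S X (λ u → suc k * T u)) ⟩
  sumOn S (λ u → X u + suc k * T u)
    ≤⟨ sumOn-mono {S = S} bound ⟩
  sumOn S (λ u → size S * T u)
    ≡⟨ sumOn-* S (size S) T ⟩
  size S * cliques G (suc k) S ∎
  where
  open ≤-Reasoning
  T : Fin n → ℕ
  T u = cliques G k (nbrs G S u)
  cell : Fin n → Fin n → ℕ
  cell v u = if ⌊ u ≟ v ⌋ then 0 else cliques G k (nbrs G (S ∖ v) u)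
  X : Fin n → ℕ
  X u = sumOn S (λ v → cell v u)

  exchange : sumOn S (λ v → cliques G (suc k) (S ∖ v)) ≡ sumOn S X
  exchange = trans
    (sum-cong (λ v → cong (λ x → if S v then x else 0)
                          (sumOn-∖ S v (λ u → cliques G k (nbrs G (S ∖ v) u)))))
    (sumOn-swap S cell)

  commute-⊆ : ∀ u v → nbrs G (S ∖ v) u ⊆ nbrs G S u ∖ v
  commute-⊆ u v w w∈ with w∈′ , uw ← ∧-true w∈ with w∈S , w≢v ← ∧-true {S w} w∈′ =
    ∧-intro (∧-intro w∈S uw) w≢v

  rearrange : ∀ a b c d e f → a + (b + c) ≤ d + e → d + f ≤ b → a + (c + f) ≤ e
  rearrange a b c d e f p q = +-cancelˡ-≤ (d + b) _ _ (begin
    d + b + (a + (c + f))    ≡⟨ shuffle a b c d f ⟩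
    a + (b + c) + (d + f)    ≤⟨ +-mono-≤ p q ⟩
    d + e + b                ≡⟨ shuffle′ b d e ⟩
    d + b + e                ∎)
    where
    shuffle : ∀ a b c d f → d + b + (a + (c + f)) ≡ a + (b + c) + (d + f)
    shuffle = solve-∀
    shuffle′ : ∀ b d e → d + e + b ≡ d + b + e
    shuffle′ = solve-∀

  -- With A = N(u) ∩ S, the cliques of A survive the deletion of any of the |S| − |A| − 1
  -- vertices of S outside A ∪ {u}, while inside A the induction hypothesis applies.
  bound : ∀ u → u ∈ S → X u + suc k * T u ≤ size S * T u
  bound u u∈S = rearrange (X u) (size A * T u) (T u) (sumOn A deleted) (size S * T u) (k * T u)
    total (cliques-average G k A)
    where
    A = nbrs G S u
    deleted : Fin n → ℕ
    deleted v = cliques G k (A ∖ v)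

    inA at : Fin n → ℕ
    inA v = if A v then T u else 0
    at v = if ⌊ v ≟ u ⌋ then T u else 0

    pointwise : ∀ v → (if S v then cell v u else 0) + (inA v + at v) ≤
                      (if A v then deleted v else 0) + (if S v then T u else 0)
    pointwise v with v ≟ u
    pointwise v | yes refl rewrite u∈S | irrefl G u with u ≟ u
    ... | yes _ = ≤-refl
    ... | no ¬p = ⊥-elim (¬p refl)
    pointwise v | no v≢u with S v | adj G u v | u ≟ v
    ... | false | _     | _      = ≤-refl
    ... | true  | _     | yes e  = ⊥-elim (v≢u (≡.sym e))
    ... | true  | true  | no _   = +-mono-≤ (cliques-mono G k (commute-⊆ u v)) (≤-reflexive (+-identityʳ _))
    ... | true  | false | no _   =
      ≤-trans (≤-reflexive (+-identityʳ _)) (cliques-mono G k (λ w w∈ → ∖⊆ A v w (commute-⊆ u v w w∈)))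

    total : X u + (size A * T u + T u) ≤ sumOn A deleted + size S * T u
    total = begin
      X u + (size A * T u + T u)
        ≡⟨ cong (X u +_) (cong₂ _+_ (trans (*-comm (size A) (T u)) (≡.sym (sumOn-const A (T u)))) (≡.sym (sum-point u (T u)))) ⟩
      X u + (sumFin n inA + sumFin n at)
        ≡⟨ cong (X u +_) (≡.sym (sum-+ inA at)) ⟩
      X u + sumFin n (λ v → inA v + at v)
        ≡⟨ ≡.sym (sum-+ (λ v → if S v then cell v u else 0) (λ v → inA v + at v)) ⟩
      sumFin n (λ v → (if S v then cell v u else 0) + (inA v + at v))
        ≤⟨ sum-mono pointwise ⟩
      sumFin n (λ v → (if A v then deleted v else 0) + (if S v then T u else 0))
        ≡⟨ sum-+ (λ v → if A v then deleted v else 0) (λ v → if S v then T u else 0) ⟩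
      sumOn A deleted + sumOn S (λ _ → T u)
        ≡⟨ cong (sumOn A deleted +_) (trans (sumOn-const S (T u)) (*-comm (T u) (size S))) ⟩
      sumOn A deleted + size S * T u ∎

-- Thinning a vertex set by averaging

-- (1 − 1/(N+1))ᵏ ≥ 1 − k/(N+1), with denominators cleared and no subtraction.
bernoulli : ∀ N k → suc N ^ k * suc N ≤ suc N * N ^ k + k * suc N ^ k
bernoulli N zero    = ≤-reflexive (base N)
  where
  base : ∀ N → 1 * suc N ≡ suc N * 1 + 0
  base = solve-∀
bernoulli N (suc k) = begin
  suc N * suc N ^ k * suc N
    ≡⟨ *-assoc (suc N) (suc N ^ k) (suc N) ⟩
  suc N * (suc N ^ k * suc N)
    ≤⟨ *-monoʳ-≤ (suc N) (bernoulli N k) ⟩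
  suc N * (suc N * N ^ k + k * suc N ^ k)
    ≡⟨ expand N (N ^ k) k (suc N ^ k) ⟩
  suc N * (N * N ^ k) + suc N * N ^ k + k * (suc N * suc N ^ k)
    ≤⟨ +-monoˡ-≤ (k * (suc N * suc N ^ k)) (+-monoʳ-≤ (suc N * (N * N ^ k)) (*-monoʳ-≤ (suc N) (^-monoˡ-≤ k (n≤1+n N)))) ⟩
  suc N * (N * N ^ k) + suc N * suc N ^ k + k * (suc N * suc N ^ k)
    ≡⟨ +-assoc (suc N * (N * N ^ k)) _ _ ⟩
  suc N * N ^ suc k + suc k * suc N ^ suc k ∎
  where
  open ≤-Reasoning
  expand : ∀ N x k y → suc N * (suc N * x + k * y) ≡ suc N * (N * x) + suc N * x + k * (suc N * y)
  expand = solve-∀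

compl : Graph n → Graph n
compl G = record
  { adj    = λ i j → not (adj G i j) ∧ not ⌊ i ≟ j ⌋
  ; sym    = λ i j → cong₂ (λ x y → not x ∧ not y) (sym G i j) (≟-sym i j)
  ; irrefl = λ i → compl-irrefl i }
  where
  ≟-sym : ∀ i j → ⌊ i ≟ j ⌋ ≡ ⌊ j ≟ i ⌋
  ≟-sym i j with i ≟ j | j ≟ i
  ... | yes _ | yes _ = refl
  ... | no  _ | no  _ = refl
  ... | yes e | no ¬e = ⊥-elim (¬e (≡.sym e))
  ... | no ¬e | yes e = ⊥-elim (¬e (≡.sym e))
  compl-irrefl : ∀ i → not (adj G i i) ∧ not ⌊ i ≟ i ⌋ ≡ false
  compl-irrefl i with adj G i i | i ≟ i
  ... | true  | _     = refl
  ... | false | yes _ = refl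
  ... | false | no ¬e = ⊥-elim (¬e refl)

compl-adj : ∀ (G : Graph n) {i j} → adj G i j ≡ false → i ≢ j → adj (compl G) i j ≡ true
compl-adj G {i} {j} e i≢j rewrite e with i ≟ j
... | yes p = ⊥-elim (i≢j p)
... | no  _ = refl

compl-nonadj : ∀ (G : Graph n) {i j} → i ≢ j → adj (compl G) i j ≡ false → adj G i j ≡ true
compl-nonadj G {i} {j} i≢j e with adj G i j | i ≟ j
... | true  | _     = refl
... | false | yes p = ⊥-elim (i≢j p)

-- One potential for both counts, so that a single thinning controls cliques and independent sets at
-- once.
homs : Graph n → ℕ → Subset n → ℕ
homs G k S = cliques G k S + cliques (compl G) k S

homs-average : ∀ (G : Graph n) k S →
  sumOn S (λ v → homs G k (S ∖ v)) + k * homs G k S ≤ size S * homs G k S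
homs-average G k S = begin
  sumOn S (λ v → homs G k (S ∖ v)) + k * homs G k S
    ≡⟨ cong (_+ k * homs G k S) (sumOn-+ S (λ v → cliques G k (S ∖ v)) (λ v → cliques (compl G) k (S ∖ v))) ⟩
  a + b + k * (c + d)          ≡⟨ regroup a b k c d ⟩
  a + k * c + (b + k * d)      ≤⟨ +-mono-≤ (cliques-average G k S) (cliques-average (compl G) k S) ⟩
  size S * c + size S * d      ≡⟨ ≡.sym (*-distribˡ-+ (size S) c d) ⟩
  size S * homs G k S          ∎
  where
  open ≤-Reasoning
  a = sumOn S (λ v → cliques G k (S ∖ v))
  b = sumOn S (λ v → cliques (compl G) k (S ∖ v))
  c = cliques G k S
  d = cliques (compl G) k S
  regroup : ∀ a b k c d → a + b + k * (c + d) ≡ a + k * c + (b + k * d)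
  regroup = solve-∀

-- Deleting a random vertex of S scales τ by a factor of at most 1 − k/|S| on average.
Averaging : (Subset n → ℕ) → ℕ → Set
Averaging τ k = ∀ S → sumOn S (λ v → τ (S ∖ v)) + k * τ S ≤ size S * τ S

-- Some deletion does as well as the average factor 1 - k/(N + 1). Weakening that factor by
-- `bernoulli` to (N/(N + 1))^k lets successive deletions telescope.
thin-by-one : ∀ {τ : Subset n → ℕ} {k} → Averaging τ k → ∀ S {N} → size S ≡ suc N →
  ∃ λ v → v ∈ S × τ (S ∖ v) * suc N ^ k ≤ τ S * N ^ k
thin-by-one {τ = τ} {k} avg S {N} eq
  with v , v∈S , small ← below-average S (λ v → τ (S ∖ v)) (subst (1 ≤_) (≡.sym eq) (s≤s z≤n))
                           (m+n≤o⇒m≤o∸n _ (avg S)) = v , v∈S , step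
  where
  open ≤-Reasoning
  small′ : suc N * τ (S ∖ v) + k * τ S ≤ suc N * τ S
  small′ = subst (λ s → s * τ (S ∖ v) + k * τ S ≤ s * τ S) eq
    (≤-trans (+-monoˡ-≤ (k * τ S) small)
      (≤-reflexive (m∸n+n≡m (≤-trans (m≤n+m (k * τ S) _) (avg S)))))
  P = suc N ^ k
  e₁ : ∀ s x P y → s * (x * P) + y * P ≡ (s * x + y) * P
  e₁ = solve-∀
  e₂ : ∀ s x P → s * x * P ≡ x * (P * s)
  e₂ = solve-∀
  e₃ : ∀ x s y k P → x * (s * y + k * P) ≡ s * (x * y) + k * x * P
  e₃ = solve-∀
  step : τ (S ∖ v) * P ≤ τ S * N ^ k
  step = *-cancelˡ-≤ (suc N) (+-cancelʳ-≤ (k * τ S * P) _ _ (begin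
    suc N * (τ (S ∖ v) * P) + k * τ S * P  ≡⟨ e₁ (suc N) (τ (S ∖ v)) P (k * τ S) ⟩
    (suc N * τ (S ∖ v) + k * τ S) * P      ≤⟨ *-monoˡ-≤ P small′ ⟩
    suc N * τ S * P                        ≡⟨ e₂ (suc N) (τ S) P ⟩
    τ S * (P * suc N)                      ≤⟨ *-monoʳ-≤ (τ S) (bernoulli N k) ⟩
    τ S * (suc N * N ^ k + k * P)          ≡⟨ e₃ (τ S) (suc N) (N ^ k) k P ⟩
    suc N * (τ S * N ^ k) + k * τ S * P    ∎))

-- The ratio τ(S)/|S|^k never increases along the deletions. For clique counts, a uniformly random
-- m-subset meets the same bound in expectation.
thin : ∀ {τ : Subset n → ℕ} {k} → Averaging τ k → ∀ m S → 1 ≤ m → m ≤ size S →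
  Σ (Subset n) λ W → W ⊆ S × size W ≡ m × τ W * size S ^ k ≤ τ S * m ^ k
thin {n} {τ} {k} avg m S 1≤m m≤S = go (size S ∸ m) S (≡.sym (m∸n+n≡m m≤S))
  where
  go : ∀ d S → size S ≡ d + m →
    Σ (Subset n) λ W → W ⊆ S × size W ≡ m × τ W * size S ^ k ≤ τ S * m ^ k
  go zero S eq = S , (λ _ v∈ → v∈) , eq , ≤-reflexive (cong (λ s → τ S * s ^ k) eq)
  go (suc d) S eq with v , v∈S , step ← thin-by-one {τ = τ} {k} avg S eq
    with size-∖v ← suc-injective (trans (size-∖ S v∈S) eq)
    with W , W⊆ , sizeW , bound ← go d (S ∖ v) size-∖v =
    W , (λ w w∈ → ∖⊆ S v w (W⊆ w w∈)) , sizeW , subst (λ s → τ W * s ^ k ≤ τ S * m ^ k) (≡.sym eq) combined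
    where
    open ≤-Reasoning
    N = d + m
    instance
      N≢0 : NonZero (N ^ k)
      N≢0 = m^n≢0 N k {{>-nonZero (≤-trans 1≤m (m≤n+m m d))}}
    bound′ : τ W * N ^ k ≤ τ (S ∖ v) * m ^ k
    bound′ = subst (λ s → τ W * s ^ k ≤ τ (S ∖ v) * m ^ k) size-∖v bound
    swap : ∀ a b c → a * b * c ≡ a * c * b
    swap = solve-∀
    combined : τ W * suc N ^ k ≤ τ S * m ^ k
    combined = *-cancelʳ-≤ _ _ (N ^ k) (begin
      τ W * suc N ^ k * N ^ k        ≡⟨ swap (τ W) _ _ ⟩
      τ W * N ^ k * suc N ^ k        ≤⟨ *-monoˡ-≤ (suc N ^ k) bound′ ⟩
      τ (S ∖ v) * m ^ k * suc N ^ k  ≡⟨ swap (τ (S ∖ v)) _ _ ⟩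
      τ (S ∖ v) * suc N ^ k * m ^ k  ≤⟨ *-monoˡ-≤ (m ^ k) step ⟩
      τ S * N ^ k * m ^ k            ≡⟨ swap (τ S) _ _ ⟩
      τ S * m ^ k * N ^ k            ∎)

-- Homogeneous sets of induced subgraphs seen by the clique counts

clique⇒cliques : ∀ (G : Graph n) k S → IsClique G S → k ≤ size S → 1 ≤ cliques G k S
clique⇒cliques G zero    S clique k≤S = ≤-refl
clique⇒cliques G (suc k) S clique k<S
  with v , v∈S ← nonempty S (≤-trans (s≤s z≤n) k<S) =
  ≤-trans (clique⇒cliques G k (nbrs G S v) clique′ k≤)
          (term≤sumOn S (λ v → cliques G k (nbrs G S v)) v∈S)
  where
  clique′ : IsClique G (nbrs G S v)
  clique′ i j i∈ j∈ = clique i j (proj₁ (∧-true i∈)) (proj₁ (∧-true j∈))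
  k≤ : k ≤ size (nbrs G S v)
  k≤ = ≤-trans (s≤s⁻¹ (≤-trans k<S (≤-reflexive (≡.sym (size-∖ S v∈S)))))
    (size-mono λ u u∈ → ∧-intro (∖⊆ S v u u∈)
      (clique v u v∈S (∖⊆ S v u u∈) (λ e → ∖-≢ S u∈ (≡.sym e))))

cliques-injection : ∀ {m} (G : Graph m) (H : Graph n) (f : Fin m → Fin n) → Injective _≡_ _≡_ f →
  (∀ i j → adj G i j ≡ true → adj H (f i) (f j) ≡ true) →
  ∀ k {R S} → (∀ i → i ∈ R → f i ∈ S) → cliques G k R ≤ cliques H k S
cliques-injection G H f inj hom zero    R→S = ≤-refl
cliques-injection {m} G H f inj hom (suc k) {R} {S} R→S =
  ≤-trans (sum-mono pointwise)
          (sum-injection f inj (λ v → if S v then cliques H k (nbrs H S v) else 0))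
  where
  pointwise : ∀ i → (if R i then cliques G k (nbrs G R i) else 0) ≤
                    (if S (f i) then cliques H k (nbrs H S (f i)) else 0)
  pointwise i with R i in e
  ... | false = z≤n
  ... | true rewrite R→S i e = cliques-injection G H f inj hom k λ j j∈ →
    ∧-intro (R→S j (proj₁ (∧-true j∈))) (hom i j (proj₂ (∧-true {R j} j∈)))

hom⇒homs : ∀ {m} (G : Graph n) (f : Fin m → Fin n) → Injective _≡_ _≡_ f → ∀ {S} → (∀ i → f i ∈ S) →
  ∀ R → IsClique (induce G f) R ⊎ IsIndependent (induce G f) R →
  ∀ k → k ≤ size R → 1 ≤ homs G k S
hom⇒homs G f inj f∈S R (inj₁ clique) k k≤R =
  ≤-trans (clique⇒cliques (induce G f) k R clique k≤R)
    (≤-trans (cliques-injection (induce G f) G f inj (λ _ _ e → e) k (λ i _ → f∈S i)) (m≤m+n _ _))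
hom⇒homs G f inj f∈S R (inj₂ independent) k k≤R =
  ≤-trans (clique⇒cliques (compl (induce G f)) k R
             (λ i j i∈ j∈ i≢j → compl-adj (induce G f) (independent i j i∈ j∈ i≢j) i≢j) k≤R)
    (≤-trans (cliques-injection (compl (induce G f)) (compl G) f inj preserves k (λ i _ → f∈S i)) (m≤n+m _ _))
  where
  preserves : ∀ i j → adj (compl (induce G f)) i j ≡ true → adj (compl G) (f i) (f j) ≡ true
  preserves i j e with adj G (f i) (f j) | i ≟ j | f i ≟ f j
  ... | false | no _   | no _  = refl
  ... | false | no i≢j | yes e = ⊥-elim (i≢j (inj e))

-- Edge counts, sparse sets and edit distance

sumOn-cong : ∀ {S : Subset n} {f g} → (∀ v → v ∈ S → f v ≡ g v) → sumOn S f ≡ sumOn S g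
sumOn-cong {S = S} {f} {g} f≡g = sum-cong pointwise
  where
  pointwise : ∀ v → (if S v then f v else 0) ≡ (if S v then g v else 0)
  pointwise v with S v in e
  ... | true  = f≡g v e
  ... | false = refl

-- `pairCount` sees only i < j. Peeling off vertex zero leaves its row; a second copy of it is the
-- missing column by symmetry, and the diagonal contributes nothing.
handshake : ∀ {n} (R : Fin n → Fin n → Bool) → (∀ i j → R i j ≡ R j i) → (∀ i → R i i ≡ false) →
  2 * pairCount R ≡ sumFin n (λ i → sumFin n (λ j → if R i j then 1 else 0))
handshake {zero}  R sym irr = refl
handshake {suc n} R sym irr = begin
  2 * (row + pairCount R′)           ≡⟨ double row (pairCount R′) ⟩
  row + (row + 2 * pairCount R′)     ≡⟨ cong₂ (λ x y → row + (x + y)) column (handshake R′ (λ i j → sym _ _) (λ i → irr _)) ⟩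
  row + (sumFin n (λ i → ind (Fin.suc i) Fin.zero) + sumFin n (λ i → sumFin n (λ j → ind (Fin.suc i) (Fin.suc j))))
    ≡⟨ cong₂ _+_ (cong (λ x → (if x then 1 else 0) + row) (≡.sym (irr Fin.zero)))
                 (≡.sym (sum-+ (λ i → ind (Fin.suc i) Fin.zero) (λ i → sumFin n (λ j → ind (Fin.suc i) (Fin.suc j))))) ⟩
  sumFin (suc n) (λ i → sumFin (suc n) (ind i)) ∎
  where
  open ≡.≡-Reasoning
  ind : Fin (suc n) → Fin (suc n) → ℕ
  ind i j = if R i j then 1 else 0
  R′ : Fin n → Fin n → Bool
  R′ i j = R (Fin.suc i) (Fin.suc j)
  row = sumFin n (λ j → ind Fin.zero (Fin.suc j))
  double : ∀ a b → 2 * (a + b) ≡ a + (a + 2 * b)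
  double = solve-∀
  column : row ≡ sumFin n (λ i → ind (Fin.suc i) Fin.zero)
  column = sum-cong {n} (λ i → cong (λ x → if x then 1 else 0) (sym Fin.zero (Fin.suc i)))

2*edgesIn : ∀ (G : Graph n) S → 2 * edgesIn G S ≡ cliques G 2 S
2*edgesIn {n} G S = trans (handshake R R-sym R-irrefl) (sum-cong pointwise)
  where
  R : Fin n → Fin n → Bool
  R i j = S i ∧ S j ∧ adj G i j
  R-sym : ∀ i j → R i j ≡ R j i
  R-sym i j rewrite sym G i j with S i | S j
  ... | true  | true  = refl
  ... | true  | false = refl
  ... | false | true  = refl
  ... | false | false = refl
  R-irrefl : ∀ i → R i i ≡ false
  R-irrefl i rewrite irrefl G i with S i
  ... | true  = refl
  ... | false = refl
  pointwise : ∀ i → sumFin n (λ j → if S i ∧ S j ∧ adj G i j then 1 else 0) ≡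
                    (if S i then size (nbrs G S i) else 0)
  pointwise i with S i
  ... | true  = refl
  ... | false = sum-zero n

degree+codegree : ∀ (G : Graph n) S i →
  size (nbrs G S i) + size (nbrs (compl G) S i) ≡ size (S ∖ i)
degree+codegree {n} G S i = trans (≡.sym (sum-+ {n} _ _)) (sum-cong pointwise)
  where
  pointwise : ∀ j → (if nbrs G S i j then 1 else 0) + (if nbrs (compl G) S i j then 1 else 0) ≡
                    (if (S ∖ i) j then 1 else 0)
  pointwise j with j ≟ i
  pointwise j | yes refl rewrite irrefl G j with S j | j ≟ j
  ... | true  | yes _ = refl
  ... | true  | no ¬e = ⊥-elim (¬e refl)
  ... | false | _     = refl
  pointwise j | no j≢i with S j | adj G i j | i ≟ j
  ... | false | _     | _     = refl
  ... | true  | _     | yes e = ⊥-elim (j≢i (≡.sym e))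
  ... | true  | true  | no _  = refl
  ... | true  | false | no _  = refl

homs-2 : ∀ (G : Graph n) S → homs G 2 S ≡ size S * (size S ∸ 1)
homs-2 G S = begin
  homs G 2 S
    ≡⟨ ≡.sym (sumOn-+ S (λ i → size (nbrs G S i)) (λ i → size (nbrs (compl G) S i))) ⟩
  sumOn S (λ i → size (nbrs G S i) + size (nbrs (compl G) S i))
    ≡⟨ sumOn-cong {S = S} (λ i i∈S → trans (degree+codegree G S i) (cong pred (size-∖ S i∈S))) ⟩
  sumOn S (λ _ → pred (size S))  ≡⟨ sumOn-const S (pred (size S)) ⟩
  pred (size S) * size S         ≡⟨ *-comm (pred (size S)) (size S) ⟩
  size S * pred (size S)         ≡⟨ cong (size S *_) (pred[n]≡n∸1 (size S)) ⟩
  size S * (size S ∸ 1)          ∎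
  where
  open ≡.≡-Reasoning
  pred[n]≡n∸1 : ∀ n → pred n ≡ n ∸ 1
  pred[n]≡n∸1 zero    = refl
  pred[n]≡n∸1 (suc n) = refl

-- Counting ordered pairs, both alternatives of `EpsHomogeneous` become this one condition, for `G`
-- or for `compl G`, and the subtraction `b ∸ a` disappears.
Sparse : ℕ → ℕ → Graph n → Subset n → Set
Sparse a b G S = b * cliques G 2 S ≤ a * (size S * (size S ∸ 1))

2*b*edgesIn : ∀ b (G : Graph n) S → 2 * b * edgesIn G S ≡ b * cliques G 2 S
2*b*edgesIn b G S = begin
  2 * b * edgesIn G S    ≡⟨ cong (_* edgesIn G S) (*-comm 2 b) ⟩
  b * 2 * edgesIn G S    ≡⟨ *-assoc b 2 _ ⟩
  b * (2 * edgesIn G S)  ≡⟨ cong (b *_) (2*edgesIn G S) ⟩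
  b * cliques G 2 S      ∎
  where open ≡.≡-Reasoning

homs-2-split : ∀ {a b} → a ≤ b → ∀ (G : Graph n) S →
  b * cliques G 2 S + b * cliques (compl G) 2 S ≡
  (b ∸ a) * (size S * (size S ∸ 1)) + a * (size S * (size S ∸ 1))
homs-2-split {a = a} {b} a≤b G S = begin
  b * cliques G 2 S + b * cliques (compl G) 2 S  ≡⟨ ≡.sym (*-distribˡ-+ b (cliques G 2 S) _) ⟩
  b * homs G 2 S           ≡⟨ cong₂ _*_ (≡.sym (m∸n+n≡m a≤b)) (homs-2 G S) ⟩
  (b ∸ a + a) * P          ≡⟨ *-distribʳ-+ P (b ∸ a) a ⟩
  (b ∸ a) * P + a * P      ∎
  where
  open ≡.≡-Reasoning
  P = size S * (size S ∸ 1)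

homogeneous⇒sparse : ∀ {a b} → a ≤ b → ∀ (G : Graph n) S →
  EpsHomogeneous a b G S → Sparse a b G S ⊎ Sparse a b (compl G) S
homogeneous⇒sparse {b = b} a≤b G S homogeneous rewrite 2*b*edgesIn b G S with homogeneous
... | inj₁ few  = inj₁ few
... | inj₂ many = inj₂ (+-cancelˡ-≤ (b * cliques G 2 S) _ _
  (≤-trans (≤-reflexive (homs-2-split a≤b G S)) (+-monoˡ-≤ _ many)))

sparse⇒homogeneous : ∀ {a b} → a ≤ b → ∀ (G : Graph n) S →
  Sparse a b G S ⊎ Sparse a b (compl G) S → EpsHomogeneous a b G S
sparse⇒homogeneous {b = b} a≤b G S sparse rewrite 2*b*edgesIn b G S with sparse
... | inj₁ few  = inj₁ few
... | inj₂ many = inj₂ (+-cancelʳ-≤ (b * cliques (compl G) 2 S) _ _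
  (≤-trans (+-monoʳ-≤ _ many) (≤-reflexive (≡.sym (homs-2-split a≤b G S)))))

pairCount-mono : ∀ {R R′ : Fin n → Fin n → Bool} → (∀ i j → R i j ≡ true → R′ i j ≡ true) →
  pairCount R ≤ pairCount R′
pairCount-mono {R = R} {R′} h = sum-mono (λ i → sum-mono (pointwise i))
  where
  pointwise : ∀ i j → (if (toℕ i <ᵇ toℕ j) ∧ R i j then 1 else 0) ≤
                      (if (toℕ i <ᵇ toℕ j) ∧ R′ i j then 1 else 0)
  pointwise i j with toℕ i <ᵇ toℕ j | R i j in e
  ... | false | _     = z≤n
  ... | true  | false = z≤n
  ... | true  | true rewrite h i j e = ≤-refl

edgesIn≤edgesIn+dist : ∀ (G H : Graph n) S → edgesIn G S ≤ edgesIn H S + dist G H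
edgesIn≤edgesIn+dist G H S = ≤-trans (sum-mono (λ i → ≤-trans (sum-mono (pointwise i)) (≤-reflexive (sum-+ (inH i) (differ i)))))
  (≤-reflexive (sum-+ (λ i → sumFin _ (inH i)) (λ i → sumFin _ (differ i))))
  where
  inH differ : Fin _ → Fin _ → ℕ
  inH i j = if (toℕ i <ᵇ toℕ j) ∧ S i ∧ S j ∧ adj H i j then 1 else 0
  differ i j = if (toℕ i <ᵇ toℕ j) ∧ (adj G i j xor adj H i j) then 1 else 0
  pointwise : ∀ i j → (if (toℕ i <ᵇ toℕ j) ∧ S i ∧ S j ∧ adj G i j then 1 else 0) ≤ inH i j + differ i j
  pointwise i j with toℕ i <ᵇ toℕ j | S i | S j | adj G i j | adj H i j
  ... | false | _     | _     | _     | _     = z≤n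
  ... | true  | false | _     | _     | _     = z≤n
  ... | true  | true  | false | _     | _     = z≤n
  ... | true  | true  | true  | false | _     = z≤n
  ... | true  | true  | true  | true  | true  = ≤-refl
  ... | true  | true  | true  | true  | false = ≤-refl

dist-compl : ∀ (G H : Graph n) → dist (compl G) (compl H) ≤ dist G H
dist-compl G H = pairCount-mono pointwise
  where
  pointwise : ∀ i j → adj (compl G) i j xor adj (compl H) i j ≡ true → adj G i j xor adj H i j ≡ true
  pointwise i j e with adj G i j | adj H i j | i ≟ j
  ... | true  | true  | _     = e
  ... | true  | false | _     = refl
  ... | false | true  | _     = refl
  ... | false | false | yes _ = e
  ... | false | false | no _  = e

dist-self : ∀ (G : Graph n) → dist G G ≡ 0
dist-self {n} G = trans (sum-cong (λ i → trans (sum-cong (pointwise i)) (sum-zero n))) (sum-zero n)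
  where
  pointwise : ∀ i j → (if (toℕ i <ᵇ toℕ j) ∧ (adj G i j xor adj G i j) then 1 else 0) ≡ 0
  pointwise i j with toℕ i <ᵇ toℕ j | adj G i j
  ... | false | _     = refl
  ... | true  | true  = refl
  ... | true  | false = refl

cliques-2-close : ∀ (G H : Graph n) S → cliques G 2 S ≤ cliques H 2 S + 2 * dist G H
cliques-2-close G H S = begin
  cliques G 2 S                        ≡⟨ ≡.sym (2*edgesIn G S) ⟩
  2 * edgesIn G S                      ≤⟨ *-monoʳ-≤ 2 (edgesIn≤edgesIn+dist G H S) ⟩
  2 * (edgesIn H S + dist G H)         ≡⟨ *-distribˡ-+ 2 (edgesIn H S) (dist G H) ⟩
  2 * edgesIn H S + 2 * dist G H       ≡⟨ cong (_+ 2 * dist G H) (2*edgesIn H S) ⟩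
  cliques H 2 S + 2 * dist G H         ∎
  where open ≤-Reasoning

-- Kleitman-Winston counting

-- All degrees in G[U] exceed (1 − 1/(u+1))|U|.
Dense : ℕ → Graph n → Subset n → Set
Dense u G U = ∀ v → v ∈ U → u * size U < suc u * size (nbrs G U v)

-- Kleitman–Winston: splitting the cliques of S according to whether they use a vertex v of low
-- degree, either S shrinks by one vertex or it shrinks by the factor u/(u+1) at the cost of one
-- clique vertex.  The latter happens at most j times before |S| ≤ D.
clique-count : ∀ (G : Graph n) u {D M K} → 1 ≤ D → n * K ≤ M * D → ∀ j S →
  size S * u ^ j ≤ D * suc u ^ j →
  (Σ (Subset n) λ U → D < size U × Dense u G U) ⊎
  (∀ k → k ≤ K → cliques G k S ≤ D ^ k * suc M ^ j)
clique-count G u {D} 1≤D nK≤MD zero S small = inj₂ λ k _ → begin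
  cliques G k S  ≤⟨ cliques≤size^ G k S ⟩
  size S ^ k     ≤⟨ ^-monoˡ-≤ k (subst₂ _≤_ (*-identityʳ (size S)) (*-identityʳ D) small) ⟩
  D ^ k          ≡⟨ ≡.sym (*-identityʳ (D ^ k)) ⟩
  D ^ k * 1      ∎
  where
  open ≤-Reasoning
clique-count {n} G u {D} {M} {K} 1≤D nK≤MD (suc j) S small with shrink (size S) S ≤-refl small
  where
  open ≤-Reasoning
  E = suc M ^ j

  1≤E : 1 ≤ E
  1≤E = m^n>0 (suc M) j

  -- `s` is fuel for the deletions within one level. The bound is linear in |S| because each deleted
  -- low-degree vertex adds at most K times the count of the next level down.
  shrink : ∀ s S → size S ≤ s → size S * u ^ suc j ≤ D * suc u ^ suc j →
    (Σ (Subset n) λ U → D < size U × Dense u G U) ⊎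
    (∀ k → k ≤ K → D * cliques G k S ≤ D ^ k * E * (D + K * size S))
  shrink s S S≤s small with size S ≤? D
  ... | yes S≤D = inj₂ λ k _ → begin
    D * cliques G k S             ≤⟨ *-monoʳ-≤ D (≤-trans (cliques≤size^ G k S) (^-monoˡ-≤ k S≤D)) ⟩
    D * D ^ k                     ≡⟨ *-comm D (D ^ k) ⟩
    D ^ k * D                     ≡⟨ cong (_* D) (≡.sym (*-identityʳ (D ^ k))) ⟩
    D ^ k * 1 * D                 ≤⟨ *-mono-≤ (*-monoʳ-≤ (D ^ k) 1≤E) (m≤m+n D (K * size S)) ⟩
    D ^ k * E * (D + K * size S)  ∎
  ... | no  S≰D with search S (λ v → suc u * size (nbrs G S v) ≤? u * size S)
  ... | inj₂ none = inj₁ (S , ≰⇒> S≰D , λ v v∈S → ≰⇒> (none v v∈S))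
  shrink zero S S≤s small | no S≰D | inj₁ _ = ⊥-elim (S≰D (≤-trans S≤s z≤n))
  shrink (suc s) S S≤s small | no S≰D | inj₁ (v , v∈S , low)
    with shrink s (S ∖ v) (s≤s⁻¹ (≤-trans (≤-reflexive (size-∖ S v∈S)) S≤s))
                (≤-trans (*-monoˡ-≤ (u ^ suc j) (size-mono (∖⊆ S v))) small)
       | clique-count G u {D} {M} {K} 1≤D nK≤MD j (nbrs G S v) small′
    where
    e₁ : ∀ u x y → suc u * (x * y) ≡ suc u * x * y
    e₁ = solve-∀
    e₂ : ∀ u x y → u * x * y ≡ x * (u * y)
    e₂ = solve-∀
    e₃ : ∀ u x y → x * (suc u * y) ≡ suc u * (x * y)
    e₃ = solve-∀
    -- The low degree of `v` absorbs one factor u/(u + 1), so its neighbourhood meets the size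
    -- hypothesis one level down.
    small′ : size (nbrs G S v) * u ^ j ≤ D * suc u ^ j
    small′ = *-cancelˡ-≤ (suc u) (begin
      suc u * (size (nbrs G S v) * u ^ j)  ≡⟨ e₁ u (size (nbrs G S v)) (u ^ j) ⟩
      suc u * size (nbrs G S v) * u ^ j    ≤⟨ *-monoˡ-≤ (u ^ j) low ⟩
      u * size S * u ^ j                   ≡⟨ e₂ u (size S) (u ^ j) ⟩
      size S * u ^ suc j                   ≤⟨ small ⟩
      D * suc u ^ suc j                    ≡⟨ e₃ u D (suc u ^ j) ⟩
      suc u * (D * suc u ^ j)              ∎)
  ... | inj₁ found | _ = inj₁ found
  ... | inj₂ _ | inj₁ found = inj₁ found
  ... | inj₂ without | inj₂ within = inj₂ bound
    where
    e₄ : ∀ D d k c → D * (d + k * c) ≡ D * d + k * (D * c)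
    e₄ = solve-∀
    e₅ : ∀ D P E K s → P * E * (D + K * s) + K * (P * E) ≡ P * E * (D + K * suc s)
    e₅ = solve-∀
    bound : ∀ k → k ≤ K → D * cliques G k S ≤ D ^ k * E * (D + K * size S)
    bound zero    _ = ≤-trans (≤-reflexive (*-comm D 1))
      (*-mono-≤ (*-monoʳ-≤ 1 1≤E) (m≤m+n D (K * size S)))
    bound (suc k) k<K = begin
      D * cliques G (suc k) S
        ≤⟨ *-monoʳ-≤ D (cliques-delete G k S v) ⟩
      D * (cliques G (suc k) (S ∖ v) + suc k * cliques G k (nbrs G S v))
        ≡⟨ e₄ D (cliques G (suc k) (S ∖ v)) (suc k) (cliques G k (nbrs G S v)) ⟩
      D * cliques G (suc k) (S ∖ v) + suc k * (D * cliques G k (nbrs G S v))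
        ≤⟨ +-mono-≤ (without (suc k) k<K) (*-mono-≤ k<K (*-monoʳ-≤ D (within k (<⇒≤ k<K)))) ⟩
      D ^ suc k * E * (D + K * size (S ∖ v)) + K * (D * (D ^ k * E))
        ≡⟨ cong (λ x → D ^ suc k * E * (D + K * size (S ∖ v)) + K * x) (≡.sym (*-assoc D (D ^ k) E)) ⟩
      D ^ suc k * E * (D + K * size (S ∖ v)) + K * (D ^ suc k * E)
        ≡⟨ e₅ D (D ^ suc k) E K (size (S ∖ v)) ⟩
      D ^ suc k * E * (D + K * suc (size (S ∖ v)))
        ≡⟨ cong (λ s → D ^ suc k * E * (D + K * s)) (size-∖ S v∈S) ⟩
      D ^ suc k * E * (D + K * size S) ∎
... | inj₁ found = inj₁ found
... | inj₂ bound = inj₂ λ k k≤K → *-cancelˡ-≤ D {{>-nonZero 1≤D}} (begin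
  D * cliques G k S                     ≤⟨ bound k k≤K ⟩
  D ^ k * suc M ^ j * (D + K * size S)  ≤⟨ *-monoʳ-≤ (D ^ k * suc M ^ j) (+-monoʳ-≤ D K|S|≤MD) ⟩
  D ^ k * suc M ^ j * (suc M * D)       ≡⟨ regroup (D ^ k) (suc M ^ j) (suc M) D ⟩
  D * (D ^ k * suc M ^ suc j)           ∎)
  where
  open ≤-Reasoning
  -- Hence D + K|S| is at most (1 + M)D, and a whole level costs one factor 1 + M.
  K|S|≤MD : K * size S ≤ M * D
  K|S|≤MD = ≤-trans (*-monoʳ-≤ K (size≤n S)) (≤-trans (≤-reflexive (*-comm K n)) nK≤MD)
  regroup : ∀ a b c d → a * b * (c * d) ≡ d * (a * (c * b))
  regroup = solve-∀

-- From the close Rödl property to Erdős-Hajnal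

cliques-2≡0⇒independent : ∀ (G : Graph n) W → cliques G 2 W ≡ 0 → IsIndependent G W
cliques-2≡0⇒independent G W none i j i∈W j∈W _ with adj G i j in ij
... | false = refl
... | true  = ⊥-elim (<-irrefl refl (begin
  1                    ≤⟨ term≤sumOn (nbrs G W i) (λ _ → 1) (∧-intro j∈W ij) ⟩
  size (nbrs G W i)    ≤⟨ term≤sumOn W (λ v → size (nbrs G W v)) i∈W ⟩
  cliques G 2 W        ≡⟨ none ⟩
  0                    ∎))
  where open ≤-Reasoning

sparse⇒independent : ∀ (G : Graph n) S {r} → 1 ≤ r → r ≤ size S → Sparse 1 (r * r) G S →
  Σ (Subset n) λ W → size W ≡ r × IsIndependent G W
sparse⇒independent G S {r} 1≤r r≤S sparse
  with W , _ , sizeW , bound ← thin {τ = cliques G 2} {2} (cliques-average G 2) r S 1≤r r≤S =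
  W , sizeW , cliques-2≡0⇒independent G W (no-edges (cliques G 2 W) (begin-strict
    cliques G 2 W * s ^ 2      ≤⟨ bound ⟩
    cliques G 2 S * r ^ 2      ≡⟨ square (cliques G 2 S) r ⟩
    r * r * cliques G 2 S      ≤⟨ sparse ⟩
    1 * (s * (s ∸ 1))          ≡⟨ *-identityˡ _ ⟩
    -- The normalisation by s(s - 1) instead of s² supplies the strict inequality that forces the
    -- integer count to be zero.
    s * (s ∸ 1)                <⟨ *-monoʳ-< s (∸-monoʳ-< {s} {1} {0} (s≤s z≤n) 1≤s) ⟩
    s * s                      ≡⟨ square′ s ⟩
    s ^ 2                      ∎))
  where
  open ≤-Reasoning
  s = size S
  1≤s : 1 ≤ s
  1≤s = ≤-trans 1≤r r≤S
  instance
    s≢0 : NonZero s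
    s≢0 = >-nonZero 1≤s
  square : ∀ x r → x * (r * (r * 1)) ≡ r * r * x
  square = solve-∀
  square′ : ∀ s → s * s ≡ s * (s * 1)
  square′ = solve-∀
  no-edges : ∀ x → x * s ^ 2 < s ^ 2 → x ≡ 0
  no-edges zero    _  = refl
  no-edges (suc x) lt = ⊥-elim (<⇒≱ lt (m≤m+n (s ^ 2) (x * s ^ 2)))

independent⇒clique : ∀ (G : Graph n) {W} → IsIndependent (compl G) W → IsClique G W
independent⇒clique G independent i j i∈ j∈ i≢j = compl-nonadj G i≢j (independent i j i∈ j∈ i≢j)

sparse⇒hom : ∀ (G : Graph n) S {r} → 1 ≤ r → r ≤ size S →
  Sparse 1 (r * r) G S ⊎ Sparse 1 (r * r) (compl G) S →
  Σ (Subset n) λ W → size W ≡ r × (IsClique G W ⊎ IsIndependent G W)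
sparse⇒hom G S 1≤r r≤S (inj₁ sparse)
  with W , eq , independent ← sparse⇒independent G S 1≤r r≤S sparse = W , eq , inj₂ independent
sparse⇒hom G S 1≤r r≤S (inj₂ sparse)
  with W , eq , independent ← sparse⇒independent (compl G) S 1≤r r≤S sparse =
  W , eq , inj₁ (independent⇒clique G independent)

-- Covers 2 ≤ n < 2^X, where the integer root r is 1 and ε = 1/r² would not be below 1/2.
hom-pair : ∀ {n} (G : Graph (2 + n)) →
  Σ (Subset (2 + n)) λ S → (IsClique G S ⊎ IsIndependent G S) × size S ≡ 2
hom-pair {n} G = pair , homogeneous (adj G 0F 1F) refl , cong (2 +_) (sum-zero n)
  where
  0F 1F : Fin (2 + n)
  0F = Fin.zero
  1F = Fin.suc Fin.zero
  pair : Subset (2 + n)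
  pair Fin.zero              = true
  pair (Fin.suc Fin.zero)    = true
  pair (Fin.suc (Fin.suc _)) = false
  uniform : ∀ {x} → adj G 0F 1F ≡ x → ∀ i j → i ∈ pair → j ∈ pair → i ≢ j → adj G i j ≡ x
  uniform e Fin.zero           Fin.zero           _ _ i≢j = ⊥-elim (i≢j refl)
  uniform e Fin.zero           (Fin.suc Fin.zero) _ _ _   = e
  uniform e (Fin.suc Fin.zero) Fin.zero           _ _ _   = trans (sym G 1F 0F) e
  uniform e (Fin.suc Fin.zero) (Fin.suc Fin.zero) _ _ i≢j = ⊥-elim (i≢j refl)
  homogeneous : ∀ x → adj G 0F 1F ≡ x → IsClique G pair ⊎ IsIndependent G pair
  homogeneous true  e = inj₁ (uniform e)
  homogeneous false e = inj₂ (uniform e)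

-- Raising the argument by one raises the integer root by at most one, so a comparison with the next
-- power decides.
root : ∀ X n → 1 ≤ X → ∃ λ r → 1 ≤ r × r ^ X ≤ suc n × suc n < suc r ^ X
root X zero    1≤X = 1 , ≤-refl , ≤-reflexive (^-zeroˡ X) ,
  ≤-trans (≤-reflexive (≡.sym (*-identityʳ 2))) (^-monoʳ-≤ 2 1≤X)
root X (suc n) 1≤X with r , 1≤r , lower , upper ← root X n 1≤X with suc r ^ X ≤? 2 + n
... | yes next = suc r , s≤s z≤n , next ,
  <-≤-trans (s≤s upper) (^-monoˡ-< X {{>-nonZero 1≤X}} (n<1+n (suc r)))
... | no  stop = r , 1≤r , m≤n⇒m≤1+n lower , ≰⇒> stop

^-cancel-≤ : ∀ {x y} k → 1 ≤ k → x ^ k ≤ y ^ k → x ≤ y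
^-cancel-≤ {x} {y} k 1≤k le = ≮⇒≥ λ y<x → <⇒≱ (^-monoˡ-< k {{>-nonZero 1≤k}} y<x) le

module _ (F : Family) where

  polyCloseRodl⇒erdosHajnal : PolyCloseRodl F → ErdosHajnal F
  polyCloseRodl⇒erdosHajnal (C₁ , C₂ , d₁ , suc d₂ , _ , 1≤C₂ , _ , _ , rodl) =
    -- Exponent 1/(2X), because n < (r + 1)^X and r + 1 ≤ r² once r ≥ 2.
    1 , 2 * X , ≤-refl , ≤-trans 1≤X (m≤m+n X _) , hom-set
    where
    -- With ε = 1/r² the promised set has |S|^C₂ ≥ r^(-2C₁) n^C₂, so n ≥ r^(2C₁ + C₂) forces |S| ≥
    -- r.
    X = 2 * C₁ + C₂

    1≤X : 1 ≤ X
    1≤X = ≤-trans 1≤C₂ (m≤n+m C₂ (2 * C₁))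

    root≤size : ∀ {n r s} → 1 ≤ r → 1 ≤ n → r ^ X ≤ n → 1 ^ C₁ * n ^ C₂ ≤ (r * r) ^ C₁ * s ^ C₂ → r ≤ s
    root≤size {n} {r} {s} 1≤r 1≤n lower bound = ^-cancel-≤ C₂ 1≤C₂
      (*-cancelˡ-≤ ((r * r) ^ C₁) {{m^n≢0 (r * r) C₁ {{>-nonZero (*-mono-≤ 1≤r 1≤r)}}}} (begin
        (r * r) ^ C₁ * r ^ C₂    ≡⟨ cong (λ x → x ^ C₁ * r ^ C₂) (cong (r *_) (≡.sym (*-identityʳ r))) ⟩
        (r ^ 2) ^ C₁ * r ^ C₂    ≡⟨ cong (_* r ^ C₂) (^-*-assoc r 2 C₁) ⟩
        r ^ (2 * C₁) * r ^ C₂    ≡⟨ ≡.sym (^-distribˡ-+-* r (2 * C₁) C₂) ⟩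
        r ^ X                    ≤⟨ lower ⟩
        n                        ≡⟨ ≡.sym (^-identityʳ n) ⟩
        n ^ 1                    ≤⟨ ^-monoʳ-≤ n {{>-nonZero 1≤n}} 1≤C₂ ⟩
        n ^ C₂                   ≡⟨ ≡.sym (*-identityˡ (n ^ C₂)) ⟩
        1 * n ^ C₂               ≡⟨ cong (_* n ^ C₂) (≡.sym (^-zeroˡ C₁)) ⟩
        1 ^ C₁ * n ^ C₂          ≤⟨ bound ⟩
        (r * r) ^ C₁ * s ^ C₂    ∎))
      where open ≤-Reasoning

    large : ∀ {n r} (G : Graph n) → F G → 1 ≤ n → 2 ≤ r → r ^ X ≤ n → n < suc r ^ X →
      Σ (Subset n) λ S → (IsClique G S ⊎ IsIndependent G S) × (n ^ 1 ≤ size S ^ (2 * X))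
    large {n} {r} G FG 1≤n 2≤r lower upper =
      let S , homogeneous , bound = rodl 1 (r * r) ≤-refl (≤-trans (n≤1+n 3) (*-mono-≤ 2≤r 2≤r)) G (G , FG , close)
          W , size≡r , hom = sparse⇒hom G S (<⇒≤ 2≤r) (root≤size (<⇒≤ 2≤r) 1≤n lower bound)
            (homogeneous⇒sparse (*-mono-≤ (<⇒≤ 2≤r) (<⇒≤ 2≤r)) G S homogeneous)
      in W , hom , (begin
        n ^ 1             ≡⟨ ^-identityʳ n ⟩
        n                 ≤⟨ <⇒≤ upper ⟩
        suc r ^ X         ≤⟨ ^-monoˡ-≤ X (begin
          1 + r  ≤⟨ +-monoˡ-≤ r (<⇒≤ 2≤r) ⟩
          r + r  ≡⟨ cong (r +_) (≡.sym (+-identityʳ r)) ⟩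
          2 * r  ≤⟨ *-monoˡ-≤ r 2≤r ⟩
          r * r  ∎) ⟩
        (r * r) ^ X       ≡⟨ cong (_^ X) (cong (r *_) (≡.sym (*-identityʳ r))) ⟩
        (r ^ 2) ^ X       ≡⟨ ^-*-assoc r 2 X ⟩
        r ^ (2 * X)       ≡⟨ cong (_^ (2 * X)) (≡.sym size≡r) ⟩
        size W ^ (2 * X)  ∎)
      where
      open ≤-Reasoning
      -- The positive exponent matters: it makes the left side vanish at distance zero, whereas
      -- `0 ^ 0` is 1.
      close : (2 * dist G G) ^ suc d₂ * (r * r) ^ d₁ ≤ 1 ^ d₁ * n ^ (2 * suc d₂)
      close rewrite dist-self G = z≤n

    hom-set : ∀ {n} (G : Graph n) → F G →
      Σ (Subset n) λ S → (IsClique G S ⊎ IsIndependent G S) × (n ^ 1 ≤ size S ^ (2 * X))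
    hom-set {zero} G FG = full , inj₁ (λ ()) , z≤n
    hom-set {suc zero} G FG = full , inj₁ (λ { Fin.zero Fin.zero _ _ 0≢0 → ⊥-elim (0≢0 refl) }) ,
      ≤-reflexive (≡.sym (^-zeroˡ (2 * X)))
    hom-set {suc (suc n)} G FG with root X (suc n) 1≤X
    ... | suc zero , _ , _ , upper with S , hom , size≡2 ← hom-pair G =
      S , hom , subst (λ s → (2 + n) ^ 1 ≤ s ^ (2 * X)) (≡.sym size≡2) (begin
        (2 + n) ^ 1    ≡⟨ ^-identityʳ (2 + n) ⟩
        2 + n          ≤⟨ <⇒≤ upper ⟩
        2 ^ X          ≤⟨ ^-monoʳ-≤ 2 (m≤m+n X _) ⟩
        2 ^ (2 * X)    ∎)
      where open ≤-Reasoning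
    ... | suc (suc r) , _ , lower , upper = large G FG (s≤s z≤n) (s≤s (s≤s z≤n)) lower upper

-- Dyadic scale and powers of 1/ε

n<2^n : ∀ n → n < 2 ^ n
n<2^n zero    = s≤s z≤n
n<2^n (suc n) = begin-strict
  suc n            ≤⟨ n<2^n n ⟩
  2 ^ n            <⟨ m<m+n (2 ^ n) (≤-trans (m^n>0 2 n) (m≤m+n (2 ^ n) 0)) ⟩
  2 ^ n + (2 ^ n + 0)  ∎
  where open ≤-Reasoning

-- Halving from a power that is plainly large enough down to the least t = 2^e ≥ 2/ε gives t ≤ 4/ε
-- by minimality. With t a power of two, m⁴ is one too, and `repeated-halving` applies without
-- logarithms.
dyadic-approximation : ∀ {a b} → 1 ≤ a → 2 * a + 1 ≤ b →
  ∃ λ e → 2 * b ≤ a * 2 ^ e × a * 2 ^ e ≤ 4 * b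
dyadic-approximation {a} {b} 1≤a 2a<b = descend (2 * b)
  (≤-trans (<⇒≤ (n<2^n (2 * b))) (≤-trans (m≤m+n _ 0) (*-monoˡ-≤ (2 ^ (2 * b)) 1≤a)))
  where
  open ≤-Reasoning
  rearrange : ∀ a x → a * (2 * x) ≡ 2 * (a * x)
  rearrange = solve-∀
  descend : ∀ e → 2 * b ≤ a * 2 ^ e → ∃ λ e → 2 * b ≤ a * 2 ^ e × a * 2 ^ e ≤ 4 * b
  descend zero lower = ⊥-elim (<-irrefl refl (begin-strict
    a            ≤⟨ m≤m+n a (a + 0) ⟩
    2 * a        <⟨ m<m+n (2 * a) (s≤s z≤n) ⟩
    2 * a + 1    ≤⟨ 2a<b ⟩
    b            ≤⟨ m≤m+n b (b + 0) ⟩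
    2 * b        ≤⟨ lower ⟩
    a * 1        ≡⟨ *-identityʳ a ⟩
    a            ∎))
  descend (suc e) lower with 2 * b ≤? a * 2 ^ e
  ... | yes lower′ = descend e lower′
  ... | no  upper  = suc e , lower , (begin
    a * 2 ^ suc e    ≡⟨ rearrange a (2 ^ e) ⟩
    2 * (a * 2 ^ e)  ≤⟨ *-monoʳ-≤ 2 (<⇒≤ (≰⇒> upper)) ⟩
    2 * (2 * b)      ≡⟨ ≡.sym (*-assoc 2 2 b) ⟩
    4 * b            ∎)

^-distribʳ-* : ∀ x y k → (x * y) ^ k ≡ x ^ k * y ^ k
^-distribʳ-* x y zero    = refl
^-distribʳ-* x y (suc k) = trans (cong (x * y *_) (^-distribʳ-* x y k)) (interchange x y (x ^ k) (y ^ k))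
  where
  interchange : ∀ a b c d → a * b * (c * d) ≡ a * c * (b * d)
  interchange = solve-∀

-- y ≤ (b / a) ^ x
PowerBound : ℕ → ℕ → ℕ → ℕ → Set
PowerBound a b x y = a ^ x * y ≤ b ^ x

module _ {a b : ℕ} where

  powerBound-* : ∀ {x y x′ y′} → PowerBound a b x y → PowerBound a b x′ y′ →
    PowerBound a b (x + x′) (y * y′)
  powerBound-* {x} {y} {x′} {y′} p p′ = begin
    a ^ (x + x′) * (y * y′)      ≡⟨ cong (_* (y * y′)) (^-distribˡ-+-* a x x′) ⟩
    a ^ x * a ^ x′ * (y * y′)    ≡⟨ interchange (a ^ x) (a ^ x′) y y′ ⟩
    a ^ x * y * (a ^ x′ * y′)    ≤⟨ *-mono-≤ p p′ ⟩
    b ^ x * b ^ x′               ≡⟨ ≡.sym (^-distribˡ-+-* b x x′) ⟩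
    b ^ (x + x′)                 ∎
    where
    open ≤-Reasoning
    interchange : ∀ a b c d → a * b * (c * d) ≡ a * c * (b * d)
    interchange = solve-∀

  powerBound-^ : ∀ {x y} k → PowerBound a b x y → PowerBound a b (k * x) (y ^ k)
  powerBound-^ zero    p = ≤-refl
  powerBound-^ {x} {y} (suc k) p = powerBound-* {x} {y} {k * x} {y ^ k} p (powerBound-^ {x} {y} k p)

-- Dense sets stay homogeneous in close graphs

-- Substituting c = s - 1 - d leaves (u + 1)d < s - 1 - u. Having s - 1 instead of s on the right
-- makes the sum over U fit the s(s - 1) in `Sparse`.
dense⇒few : ∀ u s c d → suc (d + c) ≡ s → u * s < suc u * c → suc u * d ≤ s ∸ 1
dense⇒few u s c d refl dense = +-cancelˡ-≤ (suc u + suc u * c) _ _ (begin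
  suc u + suc u * c + suc u * d       ≡⟨ expand u c d ⟩
  u * suc (d + c) + suc (d + c)       ≤⟨ +-monoˡ-≤ (suc (d + c)) (<⇒≤ dense) ⟩
  suc u * c + suc (d + c)             ≤⟨ +-monoʳ-≤ (suc u * c) (s≤s (m≤n+m (d + c) u)) ⟩
  suc u * c + suc (u + (d + c))       ≡⟨ regroup (suc u * c) u (d + c) ⟩
  suc u + suc u * c + (d + c)         ∎)
  where
  open ≤-Reasoning
  expand : ∀ u c d → suc u + suc u * c + suc u * d ≡ u * suc (d + c) + suc (d + c)
  expand = solve-∀
  regroup : ∀ x u y → x + suc (u + y) ≡ suc u + x + y
  regroup = solve-∀

dense⇒sparse : ∀ (G H : Graph n) {u U} →
  (∀ v → size (nbrs H U v) + size (nbrs G U v) ≡ size (U ∖ v)) →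
  Dense u G U → Sparse 1 (suc u) H U
dense⇒sparse G H {u} {U} complementary dense = begin
  suc u * cliques H 2 U                        ≡⟨ ≡.sym (sumOn-* U (suc u) (λ v → size (nbrs H U v))) ⟩
  sumOn U (λ v → suc u * size (nbrs H U v))
    ≤⟨ sumOn-mono {S = U} (λ v v∈U → dense⇒few u (size U) (size (nbrs G U v)) (size (nbrs H U v))
         (trans (cong suc (complementary v)) (size-∖ U v∈U)) (dense v v∈U)) ⟩
  sumOn U (λ _ → size U ∸ 1)                   ≡⟨ sumOn-const U (size U ∸ 1) ⟩
  (size U ∸ 1) * size U                        ≡⟨ *-comm (size U ∸ 1) (size U) ⟩
  size U * (size U ∸ 1)                        ≡⟨ ≡.sym (*-identityˡ _) ⟩
  1 * (size U * (size U ∸ 1))                  ∎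
  where open ≤-Reasoning

-- If H is 1/t-sparse on S then a graph at distance δ from H is a/b-sparse on S, provided
-- both error terms 1/t and 2δ / |S|(|S| − 1) are at most a/2b.
sparse-close : ∀ {a b t} (G H : Graph n) S → 2 * b ≤ a * t → Sparse 1 t H S →
  2 * b * (2 * dist G H) ≤ a * (size S * (size S ∸ 1)) → Sparse a b G S
sparse-close {a = a} {b} {t} G H S 2b≤at sparse close = *-cancelˡ-≤ 2 (begin
  2 * (b * cliques G 2 S)                        ≡⟨ ≡.sym (*-assoc 2 b _) ⟩
  2 * b * cliques G 2 S                          ≤⟨ *-monoʳ-≤ (2 * b) (cliques-2-close G H S) ⟩
  2 * b * (cliques H 2 S + 2 * dist G H)         ≡⟨ *-distribˡ-+ (2 * b) (cliques H 2 S) _ ⟩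
  2 * b * cliques H 2 S + 2 * b * (2 * dist G H) ≤⟨ +-mono-≤ sparse′ close ⟩
  a * P + a * P                                  ≡⟨ cong (a * P +_) (≡.sym (+-identityʳ (a * P))) ⟩
  2 * (a * P)                                    ∎)
  where
  open ≤-Reasoning
  P = size S * (size S ∸ 1)
  sparse′ : 2 * b * cliques H 2 S ≤ a * P
  sparse′ = begin
    2 * b * cliques H 2 S      ≤⟨ *-monoˡ-≤ (cliques H 2 S) 2b≤at ⟩
    a * t * cliques H 2 S      ≡⟨ *-assoc a t _ ⟩
    a * (t * cliques H 2 S)    ≤⟨ *-monoʳ-≤ a sparse ⟩
    a * (1 * P)                ≡⟨ cong (a *_) (*-identityˡ P) ⟩
    a * P                      ∎

-- The constant 16 is 4 · 2 · 2: the square of the 2 in n ≤ 2Ns, then s ≤ 2(s - 1), which needs s ≥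
-- 2, and a last 2 so that the changed pairs use up only half of ε. The extra factor of ε in `suc w`
-- is the ε that remains.
close-bound : ∀ {a b w n N s δ} → 1 ≤ b → 2 ≤ s → n ≤ 2 * N * s → PowerBound a b w (2 ^ 4 * N ^ 2) →
  (2 * δ) ^ 1 * b ^ suc w ≤ a ^ suc w * n ^ 2 → 2 * b * (2 * δ) ≤ a * (s * (s ∸ 1))
close-bound {a} {b} {w} {n} {N} {suc (suc s)} {δ} 1≤b (s≤s (s≤s _)) n≤ power close =
  *-cancelʳ-≤ _ _ (b ^ w) {{m^n≢0 b w {{>-nonZero 1≤b}}}} (begin
    2 * b * (2 * δ) * b ^ w                     ≡⟨ e₁ b δ (b ^ w) ⟩
    2 * ((2 * δ) ^ 1 * b ^ suc w)               ≤⟨ *-monoʳ-≤ 2 close ⟩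
    2 * (a ^ suc w * n ^ 2)                     ≤⟨ *-monoʳ-≤ 2 (*-monoʳ-≤ (a ^ suc w) n²≤) ⟩
    2 * (a ^ suc w * (8 * (N ^ 2) * P))         ≡⟨ e₂ a (a ^ w) (N ^ 2) P ⟩
    a * P * (a ^ w * (2 ^ 4 * N ^ 2))           ≤⟨ *-monoʳ-≤ (a * P) power ⟩
    a * P * b ^ w                               ∎)
  where
  open ≤-Reasoning
  P = (2 + s) * (1 + s)
  e₁ : ∀ b δ B → 2 * b * (2 * δ) * B ≡ 2 * ((2 * δ) * 1 * (b * B))
  e₁ = solve-∀
  e₂ : ∀ a A M P → 2 * (a * A * (8 * M * P)) ≡ a * P * (A * (16 * M))
  e₂ = solve-∀
  e₃ : ∀ N s → 2 * N * (2 + s) * (2 * N * (2 + s) * 1) ≡ 4 * (N * (N * 1)) * (2 + s) * (2 + s)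
  e₃ = solve-∀
  e₄ : ∀ M s → 4 * M * (2 + s) * (2 * (1 + s)) ≡ 8 * M * ((2 + s) * (1 + s))
  e₄ = solve-∀
  e₅ : ∀ s → 2 * (1 + s) ≡ 2 + s + s
  e₅ = solve-∀
  n²≤ : n ^ 2 ≤ 8 * (N ^ 2) * P
  n²≤ = begin
    n ^ 2                                  ≤⟨ ^-monoˡ-≤ 2 n≤ ⟩
    (2 * N * (2 + s)) ^ 2                  ≡⟨ e₃ N s ⟩
    4 * (N ^ 2) * (2 + s) * (2 + s)        ≤⟨ *-monoʳ-≤ (4 * (N ^ 2) * (2 + s)) (m≤m+n (2 + s) s) ⟩
    4 * (N ^ 2) * (2 + s) * (2 + s + s)    ≡⟨ cong (4 * (N ^ 2) * (2 + s) *_) (≡.sym (e₅ s)) ⟩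
    4 * (N ^ 2) * (2 + s) * (2 * (1 + s))  ≡⟨ e₄ (N ^ 2) s ⟩
    8 * (N ^ 2) * P                        ∎

-- Halving by repeated shrinking, and the sample parameters

-- (u + 1)ᵏ ≥ uᵏ + k uᵏ⁻¹, multiplied by u.
bernoulli-lower : ∀ u k → u ^ k * (u + k) ≤ u * suc u ^ k
bernoulli-lower u zero    = ≤-reflexive (base u)
  where
  base : ∀ u → 1 * (u + 0) ≡ u * 1
  base = solve-∀
bernoulli-lower u (suc k) = begin
  u * u ^ k * (u + suc k)               ≤⟨ m≤m+n _ (u ^ k * k) ⟩
  u * u ^ k * (u + suc k) + u ^ k * k   ≡⟨ factor u (u ^ k) k ⟩
  u ^ k * (u + k) * suc u               ≤⟨ *-monoˡ-≤ (suc u) (bernoulli-lower u k) ⟩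
  u * suc u ^ k * suc u                 ≡⟨ regroup u (suc u ^ k) (suc u) ⟩
  u * (suc u * suc u ^ k)               ∎
  where
  open ≤-Reasoning
  factor : ∀ u x k → u * x * (u + suc k) + x * k ≡ x * (u + k) * suc u
  factor = solve-∀
  regroup : ∀ u x t → u * x * t ≡ u * (t * x)
  regroup = solve-∀

-- (1 + 1/u)^(u + 1) ≥ 1 + (u + 1)/u ≥ 2, so u + 1 shrinkings by u/(u + 1) at least halve a set.
halving : ∀ u → 2 * u ^ suc u ≤ suc u ^ suc u
halving zero    = z≤n
halving u@(suc _) = *-cancelˡ-≤ u (begin
  u * (2 * u ^ suc u)          ≡⟨ regroup u (u ^ suc u) ⟩
  u ^ suc u * (u + u)          ≤⟨ *-monoʳ-≤ (u ^ suc u) (+-monoʳ-≤ u (n≤1+n u)) ⟩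
  u ^ suc u * (u + suc u)      ≤⟨ bernoulli-lower u (suc u) ⟩
  u * suc u ^ suc u            ∎)
  where
  open ≤-Reasoning
  regroup : ∀ u x → u * (2 * x) ≡ x * (u + u)
  regroup = solve-∀

repeated-halving : ∀ u x → 2 ^ x * u ^ (suc u * x) ≤ suc u ^ (suc u * x)
repeated-halving u x = begin
  2 ^ x * u ^ (suc u * x)       ≡⟨ cong (2 ^ x *_) (≡.sym (^-*-assoc u (suc u) x)) ⟩
  2 ^ x * (u ^ suc u) ^ x       ≡⟨ ≡.sym (^-distribʳ-* 2 (u ^ suc u) x) ⟩
  (2 * u ^ suc u) ^ x           ≤⟨ ^-monoˡ-≤ x (halving u) ⟩
  (suc u ^ suc u) ^ x           ≡⟨ ^-*-assoc (suc u) (suc u) x ⟩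
  suc u ^ (suc u * x)           ∎
  where open ≤-Reasoning

square≤4^ : ∀ x → suc x * suc x ≤ 4 ^ x
square≤4^ zero    = ≤-refl
square≤4^ (suc x) = begin
  suc (suc x) * suc (suc x)                              ≤⟨ m≤m+n _ (3 * x * x + 4 * x) ⟩
  suc (suc x) * suc (suc x) + (3 * x * x + 4 * x)        ≡⟨ expand x ⟩
  4 * (suc x * suc x)                                    ≤⟨ *-monoʳ-≤ 4 (square≤4^ x) ⟩
  4 * 4 ^ x                                              ∎
  where
  open ≤-Reasoning
  expand : ∀ x → suc (suc x) * suc (suc x) + (3 * x * x + 4 * x) ≡ 4 * (suc x * suc x)
  expand = solve-∀

-- Samples have m = t^(qν) vertices, so that n ≤ hom^q gives them hom at least k = t^ν; cliques are
-- counted with threshold D ≈ n/m³ and J = 4t log₂ m levels, and ν is chosen so that 3J ≤ k.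
module Sampling (q e u : ℕ) (1≤q : 1 ≤ q) (t≡2^e : suc u ≡ 2 ^ e) (4≤t : 4 ≤ suc u) where

  private
    t x ν m k J : ℕ
    t = suc u
    -- 12 is 3 · 4, with the 4 from m⁴ in J and the 3 from 3J ≤ k. Then 3J = t · e · xν ≤ t² · xν;
    -- the 2 in ν pays for t², and xν ≤ (x + 1)² ≤ 4^x ≤ t^x for the rest.
    x = 12 * q
    ν = 2 + x
    m = t ^ (q * ν)
    k = t ^ ν
    J = t * (e * (q * ν) * 4)

    open ≤-Reasoning

  sampleSize : ℕ
  sampleSize = m

  k^q≡m : k ^ q ≡ m
  k^q≡m = trans (^-*-assoc t ν q) (cong (t ^_) (*-comm ν q))

  k≤m : k ≤ m
  k≤m = ^-monoʳ-≤ t (≤-trans (m≤m+n ν 0) (*-monoˡ-≤ ν 1≤q))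

  4≤m : 4 ≤ m
  4≤m = ≤-trans 4≤t (≤-trans (≤-reflexive (≡.sym (^-identityʳ t)))
    (^-monoʳ-≤ t (*-mono-≤ 1≤q (s≤s (z≤n {suc x})))))

  1≤m : 1 ≤ m
  1≤m = ≤-trans (s≤s z≤n) 4≤m

  m^4≡ : m ^ 4 ≡ 2 ^ (e * (q * ν) * 4)
  m^4≡ = trans (cong (λ z → (z ^ (q * ν)) ^ 4) t≡2^e)
    (trans (cong (_^ 4) (^-*-assoc 2 e (q * ν))) (^-*-assoc 2 (e * (q * ν)) 4))

  levels-suffice : m ^ 4 * u ^ J ≤ t ^ J
  levels-suffice = subst (λ z → z * u ^ J ≤ t ^ J) (≡.sym m^4≡) (repeated-halving u (e * (q * ν) * 4))

  3J≤k : 3 * J ≤ k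
  3J≤k = begin
    3 * (t * (e * (q * ν) * 4))      ≡⟨ regroup t e q ν ⟩
    t * e * (x * ν)                  ≤⟨ *-mono-≤ (*-monoʳ-≤ t e≤t) xν≤ ⟩
    t * t * t ^ x                    ≡⟨ *-assoc t t (t ^ x) ⟩
    t ^ ν                            ∎
    where
    regroup : ∀ t e q ν → 3 * (t * (e * (q * ν) * 4)) ≡ t * e * (12 * q * ν)
    regroup = solve-∀
    e≤t : e ≤ t
    e≤t = ≤-trans (<⇒≤ (n<2^n e)) (≤-reflexive (≡.sym t≡2^e))
    slack : ∀ x → suc (x * (2 + x)) ≡ suc x * suc x
    slack = solve-∀
    xν≤ : x * ν ≤ t ^ x
    xν≤ = begin
      x * ν           ≤⟨ n≤1+n (x * ν) ⟩
      suc (x * ν)     ≡⟨ slack x ⟩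
      suc x * suc x   ≤⟨ square≤4^ x ⟩
      4 ^ x           ≤⟨ ^-monoˡ-≤ x 4≤t ⟩
      t ^ x           ∎

  1≤e : 1 ≤ e
  1≤e = lemma e t≡2^e
    where
    lemma : ∀ e → t ≡ 2 ^ e → 1 ≤ e
    lemma zero    eq = ⊥-elim (<⇒≱ 4≤t (≤-trans (≤-reflexive eq) (s≤s z≤n)))
    lemma (suc e) eq = s≤s z≤n

  1≤J : 1 ≤ J
  1≤J = *-mono-≤ (s≤s (z≤n {u})) (*-mono-≤ (*-mono-≤ 1≤e (*-mono-≤ 1≤q (s≤s (z≤n {suc x})))) (s≤s (z≤n {3})))

  -- Chosen so that n ≤ 2m³D yields nk ≤ MD, as `clique-count` asks.
  M : ℕ
  M = 2 * m ^ 3 * k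

  1+M≤m^5 : suc M ≤ m ^ 5
  1+M≤m^5 = begin
    1 + 2 * m ^ 3 * k            ≤⟨ +-mono-≤ (m^n>0 m {{>-nonZero 1≤m}} 4) (*-monoʳ-≤ (2 * m ^ 3) k≤m) ⟩
    m ^ 4 + 2 * m ^ 3 * m        ≡⟨ triple m ⟩
    3 * m ^ 4                    ≤⟨ *-monoˡ-≤ (m ^ 4) (≤-trans (n≤1+n 3) 4≤m) ⟩
    m * m ^ 4                    ∎
    where
    triple : ∀ m → m * (m * (m * (m * 1))) + 2 * (m * (m * (m * 1))) * m ≡ 3 * (m * (m * (m * (m * 1))))
    triple = solve-∀

  -- (1 + M)^J is at most m^(5J), a further m^J exceeds the 2, and 6J ≤ 2k. The right side is the
  -- m^(2k) that `too-few` has to spare.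
  few-containers : 2 * suc M ^ J < (m * m) ^ k
  few-containers = begin-strict
    2 * suc M ^ J            ≤⟨ *-monoʳ-≤ 2 (^-monoˡ-≤ J 1+M≤m^5) ⟩
    2 * (m ^ 5) ^ J          <⟨ *-monoˡ-< ((m ^ 5) ^ J) {{m^n≢0 (m ^ 5) J {{m^n≢0 m 5 {{m≢0}}}}}} 2<m^J ⟩
    m ^ J * (m ^ 5) ^ J      ≡⟨ ≡.sym (^-distribʳ-* m (m ^ 5) J) ⟩
    (m ^ 6) ^ J              ≡⟨ cong (_^ J) (cube m) ⟩
    ((m * m) ^ 3) ^ J        ≡⟨ ^-*-assoc (m * m) 3 J ⟩
    (m * m) ^ (3 * J)        ≤⟨ ^-monoʳ-≤ (m * m) {{>-nonZero (*-mono-≤ 1≤m 1≤m)}} 3J≤k ⟩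
    (m * m) ^ k              ∎
    where
    m≢0 : NonZero m
    m≢0 = >-nonZero 1≤m
    cube : ∀ m → m * (m * (m * (m * (m * (m * 1))))) ≡ m * m * (m * m * (m * m * 1))
    cube = solve-∀
    2<m^J : 2 < m ^ J
    2<m^J = begin-strict
      2        <⟨ ≤-trans (n≤1+n 3) 4≤m ⟩
      m        ≡⟨ ≡.sym (^-identityʳ m) ⟩
      m ^ 1    ≤⟨ ^-monoʳ-≤ m {{m≢0}} 1≤J ⟩
      m ^ J    ∎

  module _ (F : Family) (hereditary : Hereditary F)
           (hom-bound : ∀ {n} (G : Graph n) → F G →
              Σ (Subset n) λ S → (IsClique G S ⊎ IsIndependent G S) × (n ≤ size S ^ q)) where

    sample-has-hom : ∀ {n} (G : Graph n) → F G → ∀ W → size W ≡ m → 1 ≤ homs G k W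
    sample-has-hom G FG W size≡m with f , inj , f∈W ← enumerate W
      with R , hom , bound ← hom-bound (induce G f) (hereditary G f inj FG) =
      hom⇒homs G f inj f∈W R hom k (^-cancel-≤ q 1≤q
        (≤-trans (≤-reflexive (trans k^q≡m (≡.sym size≡m))) bound))

    private module Threshold {n} (G : Graph n) (FG : F G) (m³≤n : m ^ 3 ≤ n) where

      instance
        m³≢0 : NonZero (m ^ 3)
        m³≢0 = m^n≢0 m 3 {{>-nonZero 1≤m}}

      -- Of the three factors m, one cancels the m^k that `thin` costs, and the other two beat the
      -- factor (1 + M)^J of `clique-count`.
      D = n / m ^ 3

      1≤D : 1 ≤ D
      1≤D = m≥n⇒m/n>0 m³≤n

      n≤2m³D : n ≤ 2 * m ^ 3 * D
      n≤2m³D = begin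
        n                          ≡⟨ m≡m%n+[m/n]*n n (m ^ 3) ⟩
        n % m ^ 3 + D * m ^ 3      ≤⟨ +-monoˡ-≤ (D * m ^ 3) (<⇒≤ (m%n<n n (m ^ 3))) ⟩
        m ^ 3 + D * m ^ 3          ≤⟨ +-monoˡ-≤ (D * m ^ 3) (≤-trans (m≤m+n (m ^ 3) 0) (*-monoˡ-≤ (m ^ 3) 1≤D)) ⟩
        D * m ^ 3 + D * m ^ 3      ≡⟨ double D (m ^ 3) ⟩
        2 * m ^ 3 * D              ∎
        where
        double : ∀ D x → D * x + D * x ≡ 2 * x * D
        double = solve-∀

      nk≤MD : n * k ≤ M * D
      nk≤MD = ≤-trans (*-monoˡ-≤ k n≤2m³D) (≤-reflexive (swap (2 * m ^ 3) D k))
        where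
        swap : ∀ a b c → a * b * c ≡ a * c * b
        swap = solve-∀

      small : size (full {n}) * u ^ J ≤ D * t ^ J
      small = begin
        size (full {n}) * u ^ J    ≡⟨ cong (_* u ^ J) (size-full n) ⟩
        n * u ^ J                  ≤⟨ *-monoˡ-≤ (u ^ J) n≤2m³D ⟩
        -- The 2 from rounding down in D is absorbed by a fourth m; hence the m⁴ in
        -- `levels-suffice`.
        2 * m ^ 3 * D * u ^ J      ≤⟨ *-monoˡ-≤ (u ^ J) (*-monoˡ-≤ D (*-monoˡ-≤ (m ^ 3) (≤-trans (s≤s (s≤s z≤n)) 4≤m))) ⟩
        m ^ 4 * D * u ^ J          ≡⟨ rotate (m ^ 4) D (u ^ J) ⟩
        D * (m ^ 4 * u ^ J)        ≤⟨ *-monoʳ-≤ D levels-suffice ⟩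
        D * t ^ J                  ∎
        where
        rotate : ∀ a b c → a * b * c ≡ b * (a * c)
        rotate = solve-∀
      FewCliques : Graph n → Set
      FewCliques H = ∀ k′ → k′ ≤ k → cliques H k′ full ≤ D ^ k′ * suc M ^ J

      too-few : FewCliques G → FewCliques (compl G) → ⊥
      too-few few few′ with thin {τ = homs G k} {k} (homs-average G k) m full 1≤m m≤size-full
        where
        m≤size-full : m ≤ size (full {n})
        m≤size-full = begin
          m                ≡⟨ ≡.sym (^-identityʳ m) ⟩
          m ^ 1            ≤⟨ ^-monoʳ-≤ m {{>-nonZero 1≤m}} {1} {3} (s≤s z≤n) ⟩
          m ^ 3            ≤⟨ m³≤n ⟩
          n                ≡⟨ ≡.sym (size-full n) ⟩
          size (full {n})  ∎
      ... | W , _ , size≡m , thinned = <-irrefl refl (begin-strict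
        n ^ k                               ≡⟨ ≡.sym (*-identityˡ (n ^ k)) ⟩
        1 * n ^ k                           ≤⟨ *-monoˡ-≤ (n ^ k) (sample-has-hom G FG W size≡m) ⟩
        homs G k W * n ^ k                  ≡⟨ cong (λ z → homs G k W * z ^ k) (≡.sym (size-full n)) ⟩
        homs G k W * size (full {n}) ^ k    ≤⟨ thinned ⟩
        homs G k full * m ^ k               ≤⟨ *-monoˡ-≤ (m ^ k) (+-mono-≤ (few k ≤-refl) (few′ k ≤-refl)) ⟩
        (D ^ k * suc M ^ J + D ^ k * suc M ^ J) * m ^ k  ≡⟨ regroup (D ^ k) (suc M ^ J) (m ^ k) ⟩
        D ^ k * m ^ k * (2 * suc M ^ J)     <⟨ *-monoʳ-< (D ^ k * m ^ k) {{Dm≢0}} few-containers ⟩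
        D ^ k * m ^ k * (m * m) ^ k         ≡⟨ cong (_* (m * m) ^ k) (≡.sym (^-distribʳ-* D m k)) ⟩
        (D * m) ^ k * (m * m) ^ k           ≡⟨ ≡.sym (^-distribʳ-* (D * m) (m * m) k) ⟩
        (D * m * (m * m)) ^ k               ≡⟨ cong (_^ k) (cube D m) ⟩
        (D * m ^ 3) ^ k                     ≤⟨ ^-monoˡ-≤ k (m/n*n≤m n (m ^ 3)) ⟩
        n ^ k                               ∎)
        where
        regroup : ∀ d e m → (d * e + d * e) * m ≡ d * m * (2 * e)
        regroup = solve-∀
        cube : ∀ D m → D * m * (m * m) ≡ D * (m * (m * (m * 1)))
        cube = solve-∀
        Dm≢0 : NonZero (D ^ k * m ^ k)
        Dm≢0 = >-nonZero (*-mono-≤ (m^n>0 D {{>-nonZero 1≤D}} k) (m^n>0 m {{>-nonZero 1≤m}} k))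

    dense-subset : ∀ {n} (G : Graph n) → F G → m ^ 3 ≤ n →
      Σ (Subset n) λ U → 2 ≤ size U × n ≤ 2 * m ^ 3 * size U × (Dense u G U ⊎ Dense u (compl G) U)
    dense-subset {n} G FG m³≤n = decide (dense-or-few G) (dense-or-few (compl G))
      where
      open Threshold G FG m³≤n
      dense-or-few : ∀ H → (Σ (Subset n) λ U → D < size U × Dense u H U) ⊎ FewCliques H
      dense-or-few H = clique-count H u {D} {M} {k} 1≤D nk≤MD J full small
      large : ∀ (U : Subset n) → D < size U → (Dense u G U ⊎ Dense u (compl G) U) →
        Σ (Subset n) λ U → 2 ≤ size U × n ≤ 2 * m ^ 3 * size U × (Dense u G U ⊎ Dense u (compl G) U)
      large U D<U dense =
        U , ≤-trans (s≤s 1≤D) D<U , ≤-trans n≤2m³D (*-monoʳ-≤ (2 * m ^ 3) (<⇒≤ D<U)) , dense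
      decide : (Σ (Subset n) λ U → D < size U × Dense u G U) ⊎ FewCliques G →
        (Σ (Subset n) λ U → D < size U × Dense u (compl G) U) ⊎ FewCliques (compl G) →
        Σ (Subset n) λ U → 2 ≤ size U × n ≤ 2 * m ^ 3 * size U × (Dense u G U ⊎ Dense u (compl G) U)
      decide (inj₁ (U , D<U , dense)) _ = large U D<U (inj₁ dense)
      decide (inj₂ _) (inj₁ (U , D<U , dense)) = large U D<U (inj₂ dense)
      decide (inj₂ few) (inj₂ few′) = ⊥-elim (too-few few few′)

-- Assembly: from Erdős-Hajnal to the close Rödl property

singleton : ∀ n → Σ (Subset (suc n)) λ S → size S ≡ 1
singleton n = point , cong suc (sum-zero n)
  where
  point : Subset (suc n)
  point Fin.zero    = true
  point (Fin.suc _) = false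

homogeneous-≤1 : ∀ {a b} → a ≤ b → ∀ (G : Graph n) S → size S ≤ 1 → EpsHomogeneous a b G S
homogeneous-≤1 {a = a} {b} a≤b G S S≤1 = sparse⇒homogeneous a≤b G S (inj₁ (begin
  b * cliques G 2 S              ≤⟨ *-monoʳ-≤ b (m≤m+n (cliques G 2 S) (cliques (compl G) 2 S)) ⟩
  b * homs G 2 S                 ≡⟨ cong (b *_) (homs-2 G S) ⟩
  b * (size S * (size S ∸ 1))    ≡⟨ cong (λ x → b * (size S * x)) (m≤n⇒m∸n≡0 S≤1) ⟩
  b * (size S * 0)               ≡⟨ cong (b *_) (*-zeroʳ (size S)) ⟩
  b * 0                          ≡⟨ *-zeroʳ b ⟩
  0                              ≤⟨ z≤n ⟩
  a * (size S * (size S ∸ 1))    ∎))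
  where open ≤-Reasoning

-- Since 2 ≤ 1/ε, also t ≤ 4/ε ≤ ε^(-3), so (t^μ)³ ≤ ε^(-9μ), and each further 2 costs one more 1/ε.
-- The exponents are chosen before ε, as `PolyCloseRodl` demands.
ratio-bounds : ∀ μ → ∃ λ C → ∃ λ w → 1 ≤ C × (∀ {a b t} → 2 * a ≤ b → a * t ≤ 4 * b →
  PowerBound a b C (2 * (t ^ μ) ^ 3) × PowerBound a b w (2 ^ 4 * ((t ^ μ) ^ 3) ^ 2))
ratio-bounds μ = 1 + c , 4 * 1 + 2 * c , s≤s z≤n , λ {a} {b} {t} → bounds {a} {b} {t}
  where
  c = 3 * (μ * 3)
  bounds : ∀ {a b t} → 2 * a ≤ b → a * t ≤ 4 * b →
    PowerBound a b (1 + c) (2 * (t ^ μ) ^ 3) × PowerBound a b (4 * 1 + 2 * c) (2 ^ 4 * ((t ^ μ) ^ 3) ^ 2)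
  bounds {a} {b} {t} 2a≤b at≤4b =
    powerBound-* {a} {b} {1} {2} {c} 2-bound N-bound ,
    powerBound-* {a} {b} {4 * 1} {2 ^ 4} {2 * c} (powerBound-^ {a} {b} {1} {2} 4 2-bound)
                                                (powerBound-^ {a} {b} {c} 2 N-bound)
    where
    open ≤-Reasoning
    2-bound : PowerBound a b 1 2
    2-bound = begin
      a * 1 * 2    ≡⟨ regroup a ⟩
      2 * a        ≤⟨ 2a≤b ⟩
      b            ≡⟨ ≡.sym (*-identityʳ b) ⟩
      b * 1        ∎
      where
      regroup : ∀ a → a * 1 * 2 ≡ 2 * a
      regroup = solve-∀

    t-bound : PowerBound a b 3 t
    t-bound = begin
      a ^ 3 * t              ≡⟨ e₁ a t ⟩
      a * a * (a * t)        ≤⟨ *-monoʳ-≤ (a * a) at≤4b ⟩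
      a * a * (4 * b)        ≡⟨ e₂ a b ⟩
      2 * a * (2 * a) * b    ≤⟨ *-monoˡ-≤ b (*-mono-≤ 2a≤b 2a≤b) ⟩
      b * b * b              ≡⟨ e₃ b ⟩
      b ^ 3                  ∎
      where
      e₁ : ∀ a t → a * (a * (a * 1)) * t ≡ a * a * (a * t)
      e₁ = solve-∀
      e₂ : ∀ a b → a * a * (4 * b) ≡ 2 * a * (2 * a) * b
      e₂ = solve-∀
      e₃ : ∀ b → b * b * b ≡ b * (b * (b * 1))
      e₃ = solve-∀

    N-bound : PowerBound a b c ((t ^ μ) ^ 3)
    N-bound = powerBound-^ {a} {b} {μ * 3} 3 (powerBound-^ {a} {b} {3} μ t-bound)

module _ {a b C N : ℕ} (a≤b : a ≤ b) (2N-bound : PowerBound a b C (2 * N)) where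

  private
    open ≤-Reasoning

    size-bound : ∀ {n s} → n ≤ 2 * N * s → a ^ C * n ^ 1 ≤ b ^ C * s ^ 1
    size-bound {n} {s} n≤ = begin
      a ^ C * n ^ 1          ≡⟨ cong (a ^ C *_) (^-identityʳ n) ⟩
      a ^ C * n              ≤⟨ *-monoʳ-≤ (a ^ C) n≤ ⟩
      a ^ C * (2 * N * s)    ≡⟨ ≡.sym (*-assoc (a ^ C) (2 * N) s) ⟩
      a ^ C * (2 * N) * s    ≤⟨ *-monoˡ-≤ s 2N-bound ⟩
      b ^ C * s              ≡⟨ cong (b ^ C *_) (≡.sym (^-identityʳ s)) ⟩
      b ^ C * s ^ 1          ∎

  -- For n ≤ N the required size ε^C n is below one, so a single vertex will do, and it spans no
  -- pairs. This handles the n for which n/m³ could round to zero.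
  small-homogeneous : ∀ {n} (G : Graph n) → n ≤ N →
    Σ (Subset n) λ S → EpsHomogeneous a b G S × (a ^ C * n ^ 1 ≤ b ^ C * size S ^ 1)
  small-homogeneous {zero}  G n≤N = full , homogeneous-≤1 a≤b G full z≤n , size-bound {s = 0} z≤n
  small-homogeneous {suc n} G n≤N with S , size≡1 ← singleton n =
    S , homogeneous-≤1 a≤b G S (≤-reflexive size≡1) , size-bound (begin
      suc n            ≤⟨ n≤N ⟩
      N                ≤⟨ m≤m+n N (N + 0) ⟩
      2 * N            ≡⟨ ≡.sym (*-identityʳ (2 * N)) ⟩
      2 * N * 1        ≡⟨ cong (2 * N *_) (≡.sym size≡1) ⟩
      2 * N * size S   ∎)

  dense⇒homogeneous : ∀ {n w u} (G H : Graph n) U → 1 ≤ b → 2 * b ≤ a * suc u →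
    PowerBound a b w (2 ^ 4 * N ^ 2) → (2 * dist G H) ^ 1 * b ^ suc w ≤ a ^ suc w * n ^ 2 →
    2 ≤ size U → n ≤ 2 * N * size U → Dense u H U ⊎ Dense u (compl H) U →
    EpsHomogeneous a b G U × (a ^ C * n ^ 1 ≤ b ^ C * size U ^ 1)
  dense⇒homogeneous {n} {w} {u} G H U 1≤b 2b≤at 16N²-bound close 2≤U n≤ dense =
    sparse⇒homogeneous a≤b G U (sparse dense) , size-bound n≤
    where
    near : 2 * b * (2 * dist G H) ≤ a * (size U * (size U ∸ 1))
    near = close-bound {w = w} {N = N} {δ = dist G H} 1≤b 2≤U n≤ 16N²-bound close
    -- Where `H` is dense its complement is sparse, so the comparison is then made between the
    -- complements, which are no further apart.
    sparse : Dense u H U ⊎ Dense u (compl H) U → Sparse a b G U ⊎ Sparse a b (compl G) U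
    sparse (inj₁ dense) = inj₂ (sparse-close {a = a} {b} {suc u} (compl G) (compl H) U 2b≤at
      (dense⇒sparse H (compl H) {u} {U}
        (λ v → trans (+-comm (size (nbrs (compl H) U v)) _) (degree+codegree H U v)) dense)
      (≤-trans (*-monoʳ-≤ (2 * b) (*-monoʳ-≤ 2 (dist-compl G H))) near))
    sparse (inj₂ dense) = inj₁ (sparse-close {a = a} {b} {suc u} G H U 2b≤at
      (dense⇒sparse (compl H) H {u} {U} (degree+codegree H U) dense) near)

hom-polynomial : (F : Family) → ErdosHajnal F →
  ∃ λ q → 1 ≤ q × (∀ {n} (G : Graph n) → F G →
    Σ (Subset n) λ S → (IsClique G S ⊎ IsIndependent G S) × (n ≤ size S ^ q))
hom-polynomial F (p , q , 1≤p , 1≤q , eh) = q , 1≤q , hom-bound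
  where
  open ≤-Reasoning
  hom-bound : ∀ {n} (G : Graph n) → F G →
    Σ (Subset n) λ S → (IsClique G S ⊎ IsIndependent G S) × (n ≤ size S ^ q)
  hom-bound {zero}  G FG = full , inj₁ (λ ()) , z≤n
  hom-bound {suc n} G FG with S , hom , bound ← eh G FG = S , hom , (begin
    suc n        ≡⟨ ≡.sym (^-identityʳ (suc n)) ⟩
    suc n ^ 1    ≤⟨ ^-monoʳ-≤ (suc n) 1≤p ⟩
    suc n ^ p    ≤⟨ bound ⟩
    size S ^ q   ∎)

-- The exponent q(2 + 12q) is the qν of `Sampling`, so the cubes in `bounds` are m³. Fixing `C` and
-- `w` as parameters keeps them independent of ε.
module _ (F : Family) (hereditary : Hereditary F) {q : ℕ} (1≤q : 1 ≤ q)
         (hom-bound : ∀ {n} (G : Graph n) → F G →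
            Σ (Subset n) λ S → (IsClique G S ⊎ IsIndependent G S) × (n ≤ size S ^ q))
         {C w : ℕ}
         (bounds : ∀ {a b t} → 2 * a ≤ b → a * t ≤ 4 * b →
            PowerBound a b C (2 * (t ^ (q * (2 + 12 * q))) ^ 3) ×
            PowerBound a b w (2 ^ 4 * ((t ^ (q * (2 + 12 * q))) ^ 3) ^ 2)) where

  open ≤-Reasoning

  homogeneous-set : ∀ a b → 1 ≤ a → 2 * a + 1 ≤ b → ∀ {n} (G : Graph n) → CloseTo F a b (suc w) 1 G →
    Σ (Subset n) λ S → EpsHomogeneous a b G S × (a ^ C * n ^ 1 ≤ b ^ C * size S ^ 1)
  homogeneous-set a b 1≤a 2a<b {n} G (H , FH , close) =
    let e , lower , upper = dyadic-approximation 1≤a 2a<b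
    in at-scale e (pred (2 ^ e)) (suc-pred (2 ^ e) {{m^n≢0 2 e}}) lower upper
    where
    2a≤b : 2 * a ≤ b
    2a≤b = ≤-trans (m≤m+n (2 * a) 1) 2a<b

    a≤b : a ≤ b
    a≤b = ≤-trans (m≤m+n a (a + 0)) 2a≤b

    at-scale : ∀ e u → suc u ≡ 2 ^ e → 2 * b ≤ a * 2 ^ e → a * 2 ^ e ≤ 4 * b →
      Σ (Subset n) λ S → EpsHomogeneous a b G S × (a ^ C * n ^ 1 ≤ b ^ C * size S ^ 1)
    at-scale e u t≡2^e lower upper = by-size (N ≤? n)
      where
      2b≤at : 2 * b ≤ a * suc u
      2b≤at = subst (λ t → 2 * b ≤ a * t) (≡.sym t≡2^e) lower

      4≤t : 4 ≤ suc u
      4≤t = *-cancelˡ-≤ a {{>-nonZero 1≤a}} (begin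
        a * 4        ≡⟨ regroup a ⟩
        2 * (2 * a)  ≤⟨ *-monoʳ-≤ 2 2a≤b ⟩
        2 * b        ≤⟨ 2b≤at ⟩
        a * suc u    ∎)
        where
        regroup : ∀ a → a * 4 ≡ 2 * (2 * a)
        regroup = solve-∀

      open Sampling q e u 1≤q t≡2^e 4≤t

      N = sampleSize ^ 3

      bounds-at-t : PowerBound a b C (2 * N) × PowerBound a b w (2 ^ 4 * N ^ 2)
      bounds-at-t = bounds {a} {b} {suc u} 2a≤b (subst (λ t → a * t ≤ 4 * b) (≡.sym t≡2^e) upper)

      by-size : Dec (N ≤ n) →
        Σ (Subset n) λ S → EpsHomogeneous a b G S × (a ^ C * n ^ 1 ≤ b ^ C * size S ^ 1)
      by-size (no  N≰n) = small-homogeneous {a} {b} {C} {N} a≤b (proj₁ bounds-at-t) G (≰⇒≥ N≰n)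
      by-size (yes N≤n) =
        let U , 2≤U , n≤ , dense = dense-subset F hereditary hom-bound H FH N≤n in
        U , dense⇒homogeneous {a} {b} {C} {N} a≤b (proj₁ bounds-at-t) {n} {w} {u} G H U (≤-trans 1≤a a≤b) 2b≤at
              (proj₂ bounds-at-t) close 2≤U n≤ dense

erdosHajnal⇒polyCloseRodl : (F : Family) → Hereditary F → ErdosHajnal F → PolyCloseRodl F
erdosHajnal⇒polyCloseRodl F hereditary eh =
  let q , 1≤q , hom-bound = hom-polynomial F eh
      C , w , 1≤C , bounds = ratio-bounds (q * (2 + 12 * q))
  in C , 1 , suc w , 1 , 1≤C , ≤-refl , s≤s z≤n , ≤-refl ,
     homogeneous-set F hereditary 1≤q hom-bound {C} {w} (λ {a} {b} {t} → bounds {a} {b} {t})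

theorem1p11 : (F : Family) → Hereditary F → (ErdosHajnal F ⇔ PolyCloseRodl F)
theorem1p11 F hereditary = mk⇔ (erdosHajnal⇒polyCloseRodl F hereditary) (polyCloseRodl⇒erdosHajnal F)
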